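{- Let $P$ be a polytope of type $\mathbf A$. Then the lattice dicing subdivision of $P$ obtained by slicing $P$ by all lattice hyperplanes with normal in the root system $\mathbf A_{n-1}$ is a quadratic triangulation of $P$.
   Context: Let $\mathbf A_{n-1}=\{e_i-e_j: i\ne j,\ 1\le i,j\le n\}\subset\mathbb{R}^n$, $V=\{x\in\mathbb{R}^n:\sum_i x_i=0\}$, and $\Lambda^*=\{x\in V:\langle v,x\rangle\in\mathbb{Z}\ \forall v\in\mathbf A_{n-1}\}$. A polytope of type $\mathbf A$ is a lattice polytope with respect to $\Lambda^*$ (vertices in $\Lambda^*$), full-dimensional in $V$, each of whose facet-defining hyperplanes has the form $\{x\in V:\langle v,x\rangle=w\}$ with $v\in\mathbf A_{n-1}$, $w\in\mathbb{Z}$. The lattice hyperplanes with normal in $\mathbf A_{n-1}$ are $\{x\in V:\langle e_i-e_j,x\rangle=k\}$, $k\in\mathbb{Z}$. A quadratic triangulation is a triangulation that is regular (induced by a weight vector on the lattice points), unimodular with respect to $\Lambda^*$, and flag (every minimal non-face has two elements).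
   Formalization: Points of P, of V and of the dicing cells are taken with rational instead of real coordinates, and normals, facet levels and convex coefficients are rational; no polytope of type A is excluded, since all vertices are rational. -}

module Defs where

open import Data.Nat using (ℕ; zero; suc; _∸_)
open import Data.Fin using (Fin; zero; suc)
open import Data.Integer as ℤ using (ℤ)
open import Data.Rational using (ℚ; 0ℚ; 1ℚ; _+_; _*_; _-_; _≤_; _<_; _/_)
open import Data.Product using (Σ; ∃; ∃-syntax; _×_)
open import Data.Bool using (Bool; true; false)
open import Relation.Binary.PropositionalEquality using (_≡_; _≢_)
open import Relation.Nullary using (¬_)
open import Function.Bundles using (_⇔_)

-- Points of ℚⁿ (all objects in the statement are rational polyhedra)

Pt : ℕ → Set
Pt n = Fin n → ℚ

_≐_ : ∀ {n} → Pt n → Pt n → Set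
x ≐ y = ∀ i → x i ≡ y i

sumℚ : ∀ {m} → (Fin m → ℚ) → ℚ
sumℚ {zero}  f = 0ℚ
sumℚ {suc m} f = f zero + sumℚ (λ l → f (suc l))

⟨_,_⟩ : ∀ {n} → Pt n → Pt n → ℚ
⟨ a , x ⟩ = sumℚ (λ i → a i * x i)

ι : ℤ → ℚ
ι z = z / 1

IsInt : ℚ → Set
IsInt q = ∃[ z ] q ≡ ι z

lincomb : ∀ {m n} → (Fin m → ℚ) → (Fin m → Pt n) → Pt n
lincomb c W i = sumℚ (λ l → c l * W l i)

InV : ∀ {n} → Pt n → Set
InV x = sumℚ x ≡ 0ℚ

dimV : ℕ → ℕ
dimV n = n ∸ 1

-- ⟨ e_i - e_j , x ⟩
root : ∀ {n} → Fin n → Fin n → Pt n → ℚ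
root i j x = x i - x j

InΛ : ∀ {n} → Pt n → Set
InΛ {n} x = InV x × (∀ (i j : Fin n) → i ≢ j → IsInt (root i j x))

AffInd : ∀ {m n} → (Fin m → Pt n) → Set
AffInd {m} W = (c : Fin m → ℚ) → sumℚ c ≡ 0ℚ → lincomb c W ≐ (λ _ → 0ℚ) →
               ∀ l → c l ≡ 0ℚ

ConvComb : ∀ {m n} → (Fin m → Pt n) → (Fin m → ℚ) → Pt n → Set
ConvComb W lam x = (∀ l → 0ℚ ≤ lam l) × sumℚ lam ≡ 1ℚ × x ≐ lincomb lam W

Conv : ∀ {m n} → (Fin m → Pt n) → Pt n → Set
Conv W x = ∃[ lam ] ConvComb W lam x

-- a set S ⊆ ℚⁿ contains k affinely independent points
-- (i.e. its affine dimension is at least k - 1)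
HasAffIndep : ∀ {n} → ℕ → (Pt n → Set) → Set
HasAffIndep {n} k S = Σ (Fin k → Pt n) λ W → (∀ l → S (W l)) × AffInd W

FullDimInV : ∀ {n} → (Pt n → Set) → Set
FullDimInV {n} S = HasAffIndep (suc (dimV n)) S

-- the hyperplane {x ∈ V : ⟨a,x⟩ = b} is facet-defining for S, S full-dim in V:
-- a is not orthogonal to V (so this is a hyperplane of V), S lies on one side,
-- and S ∩ H has dimension dim V - 1.
FacetDefining : ∀ {n} → (Pt n → Set) → Pt n → ℚ → Set
FacetDefining {n} S a b =
  (∃[ i ] ∃[ j ] a i ≢ a j) ×
  (∀ x → S x → ⟨ a , x ⟩ ≤ b) ×
  HasAffIndep (dimV n) (λ x → S x × ⟨ a , x ⟩ ≡ b)

Polytope : ∀ {m n} → (Fin m → Pt n) → Pt n → Set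
Polytope = Conv

IsTypeA : ∀ {m n} → (Fin m → Pt n) → Set
IsTypeA {m} {n} vs =
  (∀ l → InΛ (vs l)) ×
  FullDimInV (Polytope vs) ×
  (∀ (a : Pt n) (b : ℚ) → FacetDefining (Polytope vs) a b →
     Σ (Fin n) λ i → Σ (Fin n) λ j → Σ ℤ λ w → i ≢ j ×
       (∀ x → InV x → (⟨ a , x ⟩ ≡ b) ⇔ (root i j x ≡ ι w)))

DicingCell : ∀ {m n} → (Fin m → Pt n) → (Fin n → Fin n → ℤ) → Pt n → Set
DicingCell {n = n} vs k x =
  Polytope vs x ×
  (∀ (i j : Fin n) → i ≢ j →
     (ι (k i j) ≤ root i j x) × (root i j x ≤ ι (k i j ℤ.+ ℤ.+ 1)))

-- the maximal cells of the dicing: the full-dimensional ones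
-- (= closures of the regions of P minus all lattice hyperplanes x_i - x_j ∈ ℤ)
DicingIndex : ∀ {m n} → (Fin m → Pt n) → Set
DicingIndex {n = n} vs = Σ (Fin n → Fin n → ℤ) λ k → FullDimInV (DicingCell vs k)

module _ {n : ℕ} (P : Pt n → Set) (I : Set) (C : I → Pt n → Set) where

  private
    d = dimV n

  IsVertex : (I → Fin (suc d) → Pt n) → Pt n → Set
  IsVertex W p = ∃[ t ] ∃[ l ] p ≐ W t l

  IsFaceSel : (I → Fin (suc d) → Pt n) → ∀ {r} → (Fin r → Pt n) → (Fin r → Bool) → Set
  IsFaceSel W S mask = ∃[ t ] ∀ a → mask a ≡ true → ∃[ l ] S a ≐ W t l

  IsQuadraticTriangulation : Set
  IsQuadraticTriangulation =
    Σ (I → Fin (suc d) → Pt n) λ W →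
      (∀ t → AffInd (W t) × (∀ x → C t x ⇔ Conv (W t) x)) ×
      (∀ x → P x ⇔ (∃[ t ] C t x)) ×
      -- two cells intersect in a common face (conv of common vertices)
      (∀ t u x → (C t x × C u x) ⇔
         (∃[ lam ] ConvComb (W t) lam x × (∀ l → lam l ≢ 0ℚ → ∃[ l' ] W t l ≐ W u l'))) ×
      -- unimodular: vertices in Λ*, edge vectors form a ℤ-basis of Λ*
      (∀ t → (∀ l → InΛ (W t l)) ×
         (∀ (y : Pt n) → InΛ y → Σ (Fin d → ℤ) λ c → (∀ i → y i ≡
            sumℚ (λ l → ι (c l) * (W t (suc l) i - W t zero i))))) ×
      -- regular: induced by a weight vector ω on the lattice points of P
      (Σ (Pt n → ℚ) λ ω → ∀ t → Σ (Pt n) λ a → Σ ℚ λ b →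
         (∀ l → ⟨ a , W t l ⟩ + b ≡ ω (W t l)) ×
         (∀ (p : Pt n) → InΛ p → P p → (∀ l → ¬ (p ≐ W t l)) → ⟨ a , p ⟩ + b < ω p)) ×
      -- flag: every minimal non-face has exactly two elements
      (∀ (r : ℕ) (S : Fin r → Pt n) →
         (∀ (a b : Fin r) → a ≢ b → ¬ (S a ≐ S b)) →
         (∀ (a : Fin r) → IsVertex W (S a)) →
         ¬ IsFaceSel W S (λ _ → true) →
         (∀ (mask : Fin r → Bool) → (∃[ a ] mask a ≡ false) → IsFaceSel W S mask) →
         r ≡ 2)

{-# OPTIONS --safe #-}

-- Slice V by all hyperplanes x i - x j ∈ ℤ and pick y off all of them. Write y i = m i + f i with
-- m i integral and 0 ≤ f i < 1, and let σ order the coordinates by decreasing f. The closed region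
-- of y is then given by x (σ 0) - m (σ 0) ≥ … ≥ x (σ d) - m (σ d) ≥ x (σ 0) - m (σ 0) - 1, a
-- simplex. The slacks of these d + 1 inequalities sum to 1 and are its barycentric coordinates;
-- they are integral on Λ*, so the simplex is unimodular and contains no lattice points besides its
-- vertices.
--
-- P is a union of such simplices: if p lies in the closed region of some y ∈ P but not in P, a
-- facet hyperplane x i - x j = w of P cuts the segment from y to p before p, although x i - x j is
-- not an integer there. Facets that separate p from P come from Farkas' lemma, the separating
-- functional being turned until it is tight on d affinely independent vertices of P.
--
-- A vertex with positive weight in x satisfies every lattice inequality that x satisfies; hence
-- two simplices meet in a common face. At the integers, a square lies above its secant over a unit
-- interval, with equality only at the two ends; so the weight Σ (x i - x j)² induces the dicing.
-- If all pairs of a set of vertices are edges, each x i - x j varies by at most 1 on the set, so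
-- the region that contains its barycentre contains the set; hence the flag property.
module Submission where

open import Defs
open import Data.Bool using (Bool; true; false; _∨_)
open import Data.Bool.Properties using (∨-zeroʳ)
open import Data.Empty using (⊥; ⊥-elim)
open import Data.Fin as Fin using (Fin; zero; suc; punchIn; punchOut; toℕ)
import Data.Fin.Properties as Fin
open import Data.Integer as ℤ using (ℤ)
import Data.Integer.DivMod as ℤ
import Data.Integer.Properties as ℤ
open import Data.Integer.Tactic.RingSolver using (solve-∀)
open import Data.Nat as ℕ using (ℕ; zero; suc; s<s)
import Data.Nat.Properties as ℕ
open import Data.Product using (Σ; ∃-syntax; _×_; _,_; proj₁; proj₂)
open import Data.Rational hiding (floor; _≟_)
open import Data.Rational.Properties
open import Data.Rational.Solver using (module +-*-Solver)
open import Data.Rational.Unnormalised as ℚᵘ using (mkℚᵘ; *≡*)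
import Data.Rational.Unnormalised.Properties as ℚᵘ
open import Data.Sum using (_⊎_; inj₁; inj₂)
open import Data.Vec.Functional using (_∷_)
open import Function using (_∘_; case_of_; _∋_)
open import Function.Bundles using (_⇔_; mk⇔; Equivalence)
open import Relation.Binary.Definitions using (tri<; tri≈; tri>)
open import Relation.Binary.PropositionalEquality hiding ([_])
open import Relation.Nullary using (¬_; Dec; yes; no; ¬?; contradiction)
open import Relation.Nullary.Decidable using (decidable-stable; does; dec-true; dec-false)
open +-*-Solver using (solve; _:=_; _:+_; _:*_; _:-_; :-_; con)

-- Ordered field arithmetic

-- The difference enters as a separate `e`, so that each inequality below splits into a sign
-- argument for some convenient expression and a ring identity that equates this expression with the
-- difference.
≤-by : ∀ {a b e} → 0ℚ ≤ e → e ≡ b - a → a ≤ b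
≤-by {a} {b} p refl = subst₂ _≤_ (+-identityˡ a) (b - a + a ≡ b ∋
      solve 2 (λ a b → a :- b :+ b := a) refl b a) (+-monoˡ-≤ a p)

<-by : ∀ {a b e} → 0ℚ < e → e ≡ b - a → a < b
<-by {a} {b} p refl = subst₂ _<_ (+-identityˡ a) (b - a + a ≡ b ∋
      solve 2 (λ a b → a :- b :+ b := a) refl b a) (+-monoˡ-< a p)

≡-by : ∀ {a b e} → e ≡ 0ℚ → e ≡ a - b → a ≡ b
≡-by {a} {b} {e} p q = begin
  a           ≡⟨ solve 2 (λ a b → a := a :- b :+ b) refl a b ⟩
  a - b + b   ≡⟨ cong (_+ b) (trans (sym q) p) ⟩
  0ℚ + b      ≡⟨ +-identityˡ b ⟩
  b           ∎
  where open ≡-Reasoning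

0≤- : ∀ {a b} → a ≤ b → 0ℚ ≤ b - a
0≤- {a} {b} p = subst (_≤ b - a) (+-inverseʳ a) (+-monoˡ-≤ (- a) p)

0<- : ∀ {a b} → a < b → 0ℚ < b - a
0<- {a} {b} p = subst (_< b - a) (+-inverseʳ a) (+-monoˡ-< (- a) p)

0≡- : ∀ {a b} → a ≡ b → a - b ≡ 0ℚ
0≡- {a} refl = +-inverseʳ a

0≤+ : ∀ {a b} → 0ℚ ≤ a → 0ℚ ≤ b → 0ℚ ≤ a + b
0≤+ {a} {b} p q = subst (_≤ a + b) (+-identityˡ 0ℚ) (+-mono-≤ p q)

0<+ : ∀ {a b} → 0ℚ < a → 0ℚ ≤ b → 0ℚ < a + b
0<+ {a} {b} p q = subst (_< a + b) (+-identityˡ 0ℚ) (+-mono-<-≤ p q)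

0≡+ : ∀ {a b} → a ≡ 0ℚ → b ≡ 0ℚ → a + b ≡ 0ℚ
0≡+ refl refl = refl

0≤* : ∀ {a b} → 0ℚ ≤ a → 0ℚ ≤ b → 0ℚ ≤ a * b
0≤* {a} {b} p q = subst (_≤ a * b) (*-zeroʳ a) (*-monoˡ-≤-nonNeg a {{nonNegative p}} q)

0<* : ∀ {a b} → 0ℚ < a → 0ℚ < b → 0ℚ < a * b
0<* {a} {b} p q = subst (_< a * b) (*-zeroʳ a) (*-monoʳ-<-pos a {{positive p}} q)

0≡* : ∀ s {a} → a ≡ 0ℚ → s * a ≡ 0ℚ
0≡* s refl = *-zeroʳ s

0≤1 : 0ℚ ≤ 1ℚ
0≤1 = nonNegative⁻¹ 1ℚ

0<1 : 0ℚ < 1ℚ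
0<1 = positive⁻¹ 1ℚ

<0⇒0<- : ∀ {a} → a < 0ℚ → 0ℚ < - a
<0⇒0<- {a} p = <-by (0<- p) (solve 1 (λ a → con 0ℚ :- a := (:- a) :- con 0ℚ) refl a)

<-absurd : ∀ {a} → 0ℚ < a → a ≢ 0ℚ
<-absurd p q = <-irrefl (sym q) p

≢0⇒<0∨>0 : ∀ {a} → a ≢ 0ℚ → a < 0ℚ ⊎ 0ℚ < a
≢0⇒<0∨>0 {a} a≢0 with <-cmp a 0ℚ
... | tri< p _ _ = inj₁ p
... | tri≈ _ p _ = contradiction p a≢0
... | tri> _ _ p = inj₂ p

0≤∧≢0⇒0< : ∀ {a} → 0ℚ ≤ a → a ≢ 0ℚ → 0ℚ < a
0≤∧≢0⇒0< 0≤a a≢0 with ≢0⇒<0∨>0 a≢0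
... | inj₁ a<0 = ⊥-elim (<-irrefl refl (≤-<-trans 0≤a a<0))
... | inj₂ 0<a = 0<a

recip : ∀ r → r ≢ 0ℚ → ∃[ s ] r * s ≡ 1ℚ
recip r r≢0 = 1/_ r {{nz}} , *-inverseʳ r {{nz}}
  where
  nz : NonZero r
  nz = ≢-nonZero r≢0

recip-pos : ∀ r → 0ℚ < r → ∃[ s ] (0ℚ < s × r * s ≡ 1ℚ)
recip-pos r 0<r = 1/_ r {{nz}} , positive⁻¹ _ {{1/pos⇒pos r {{positive 0<r}}}} , *-inverseʳ r {{nz}}
  where
  nz : NonZero r
  nz = ≢-nonZero (<-absurd 0<r)

*≡0 : ∀ {a b} → a * b ≡ 0ℚ → a ≢ 0ℚ → b ≡ 0ℚ
*≡0 {a} {b} ab≡0 a≢0 with recip a a≢0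
... | s , as≡1 = begin
  b
    ≡⟨ solve 3 (λ a b c → a := (con 1ℚ :- b :* c) :* a :+ c :* (b :* a)) refl b a s ⟩
  (1ℚ - a * s) * b + s * (a * b) ≡⟨ cong₂ (λ u v → (1ℚ - u) * b + s * v) as≡1 ab≡0 ⟩
  (1ℚ - 1ℚ) * b + s * 0ℚ
    ≡⟨ solve 2 (λ a b → (con 1ℚ :- con 1ℚ) :* a :+ b :* con 0ℚ := con 0ℚ) refl b s ⟩
  0ℚ                             ∎
  where open ≡-Reasoning

0≤sq : ∀ a → 0ℚ ≤ a * a
0≤sq a with ≤-total 0ℚ a
... | inj₁ p = 0≤* p p
... | inj₂ p = ≤-by (0≤* (0≤- p) (0≤- p))
      (solve 1 (λ a → (con 0ℚ :- a) :* (con 0ℚ :- a) := a :* a :- con 0ℚ) refl a)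

0<sq : ∀ {a} → a ≢ 0ℚ → 0ℚ < a * a
0<sq {a} a≢0 = 0≤∧≢0⇒0< (0≤sq a) (λ p → a≢0 (*≡0 p a≢0))

-- Finite sums

sum-cong : ∀ {m} {f g : Fin m → ℚ} → (∀ l → f l ≡ g l) → sumℚ f ≡ sumℚ g
sum-cong {zero}  p = refl
sum-cong {suc m} p = cong₂ _+_ (p zero) (sum-cong (p ∘ suc))

sum-0 : ∀ {m} {f : Fin m → ℚ} → (∀ l → f l ≡ 0ℚ) → sumℚ f ≡ 0ℚ
sum-0 {zero}  p = refl
sum-0 {suc m} p = 0≡+ (p zero) (sum-0 (p ∘ suc))

sum-* : ∀ {m} s (g : Fin m → ℚ) → sumℚ (λ l → s * g l) ≡ s * sumℚ g
sum-* {zero}  s g = sym (*-zeroʳ s)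
sum-* {suc m} s g = trans (cong (s * g zero +_) (sum-* s (g ∘ suc))) (sym (*-distribˡ-+ s (g zero) (sumℚ (g ∘ suc))))

sum-+ : ∀ {m} (f g : Fin m → ℚ) → sumℚ (λ l → f l + g l) ≡ sumℚ f + sumℚ g
sum-+ {zero}  f g = refl
sum-+ {suc m} f g = begin
  f zero + g zero + sumℚ (λ l → f (suc l) + g (suc l)) ≡⟨ cong (f zero + g zero +_) (sum-+ (f ∘ suc) (g ∘ suc)) ⟩
  f zero + g zero + (sumℚ (f ∘ suc) + sumℚ (g ∘ suc))
    ≡⟨ solve 4 (λ a b c d → a :+ b :+ (c :+ d) := a :+ c :+ (b :+ d))
         refl (f zero) (g zero) (sumℚ (f ∘ suc)) (sumℚ (g ∘ suc)) ⟩
  f zero + sumℚ (f ∘ suc) + (g zero + sumℚ (g ∘ suc))  ∎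
  where open ≡-Reasoning

sum-+* : ∀ {m} (f : Fin m → ℚ) s (g : Fin m → ℚ) →
         sumℚ (λ l → f l + s * g l) ≡ sumℚ f + s * sumℚ g
sum-+* f s g = trans (sum-+ f (λ l → s * g l)) (cong (sumℚ f +_) (sum-* s g))

sum-minus : ∀ {m} (f g : Fin m → ℚ) → sumℚ (λ l → f l - g l) ≡ sumℚ f - sumℚ g
sum-minus {zero}  f g = refl
sum-minus {suc m} f g = begin
  f zero - g zero + sumℚ (λ l → f (suc l) - g (suc l)) ≡⟨ cong (f zero - g zero +_) (sum-minus (f ∘ suc) (g ∘ suc)) ⟩
  f zero - g zero + (sumℚ (f ∘ suc) - sumℚ (g ∘ suc))
    ≡⟨ solve 4 (λ a b c d → a :- b :+ (c :- d) := a :+ c :- (b :+ d))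
         refl (f zero) (g zero) (sumℚ (f ∘ suc)) (sumℚ (g ∘ suc)) ⟩
  f zero + sumℚ (f ∘ suc) - (g zero + sumℚ (g ∘ suc))  ∎
  where open ≡-Reasoning

sum-swap : ∀ {m k} (f : Fin m → Fin k → ℚ) →
           sumℚ (λ i → sumℚ (f i)) ≡ sumℚ (λ j → sumℚ (λ i → f i j))
sum-swap {zero}  {k} f = sym (sum-0 {k} (λ _ → refl))
sum-swap {suc m} {k} f =
  trans (cong (sumℚ (f zero) +_) (sum-swap (f ∘ suc)))
        (sym (sum-+ (f zero) (λ j → sumℚ (λ i → f (suc i) j))))

sum-nonneg : ∀ {m} {f : Fin m → ℚ} → (∀ l → 0ℚ ≤ f l) → 0ℚ ≤ sumℚ f
sum-nonneg {zero}  p = ≤-refl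
sum-nonneg {suc m} p = 0≤+ (p zero) (sum-nonneg (p ∘ suc))

sum-pos : ∀ {m} {f : Fin m → ℚ} → (∀ l → 0ℚ ≤ f l) → ∃[ l ] 0ℚ < f l → 0ℚ < sumℚ f
sum-pos {suc m}     p (zero , q)  = 0<+ q (sum-nonneg (p ∘ suc))
sum-pos {suc m} {f} p (suc l , q) =
  subst (0ℚ <_) (+-comm (sumℚ (f ∘ suc)) (f zero)) (0<+ (sum-pos (p ∘ suc) (l , q)) (p zero))

sum-nonneg-≡0 : ∀ {m} {f : Fin m → ℚ} → (∀ l → 0ℚ ≤ f l) → sumℚ f ≡ 0ℚ → ∀ l → f l ≡ 0ℚ
sum-nonneg-≡0 {f = f} p q l with f l ≟ 0ℚ
... | yes r = r
... | no  r = ⊥-elim (<-absurd (sum-pos p (l , 0≤∧≢0⇒0< (p l) r)) q)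

-- Linear algebra in ℚⁿ

axpy : ∀ {n} → Pt n → ℚ → Pt n → Pt n
axpy x s y i = x i + s * y i

dot-comm : ∀ {n} (a x : Pt n) → ⟨ a , x ⟩ ≡ ⟨ x , a ⟩
dot-comm a x = sum-cong (λ i → *-comm (a i) (x i))

dot-congʳ : ∀ {n} (a : Pt n) {x y : Pt n} → x ≐ y → ⟨ a , x ⟩ ≡ ⟨ a , y ⟩
dot-congʳ a p = sum-cong (λ i → cong (a i *_) (p i))

dot-axpyʳ : ∀ {n} (a x : Pt n) s (y : Pt n) → ⟨ a , axpy x s y ⟩ ≡ ⟨ a , x ⟩ + s * ⟨ a , y ⟩
dot-axpyʳ a x s y =
  trans (sum-cong λ i → a i * (x i + s * y i) ≡ a i * x i + s * (a i * y i) ∋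
        solve 4 (λ a b c d → a :* (b :+ c :* d) := a :* b :+ c :* (a :* d)) refl (a i) (x i) s (y i))
        (sum-+* (λ i → a i * x i) s (λ i → a i * y i))

dot-axpyˡ : ∀ {n} (x : Pt n) s (y a : Pt n) → ⟨ axpy x s y , a ⟩ ≡ ⟨ x , a ⟩ + s * ⟨ y , a ⟩
dot-axpyˡ x s y a = trans (dot-comm (axpy x s y) a)
  (trans (dot-axpyʳ a x s y) (cong₂ (λ u v → u + s * v) (dot-comm a x) (dot-comm a y)))

dot-0ʳ : ∀ {n} (a : Pt n) {x : Pt n} → (∀ i → x i ≡ 0ℚ) → ⟨ a , x ⟩ ≡ 0ℚ
dot-0ʳ a p = sum-0 (λ i → 0≡* (a i) (p i))

dot-lincomb : ∀ {m n} (a : Pt n) (c : Fin m → ℚ) (W : Fin m → Pt n) →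
              ⟨ a , lincomb c W ⟩ ≡ sumℚ (λ l → c l * ⟨ a , W l ⟩)
dot-lincomb a c W = begin
  sumℚ (λ i → a i * sumℚ (λ l → c l * W l i))
    ≡⟨ sum-cong (λ i → sym (sum-* (a i) (λ l → c l * W l i))) ⟩
  sumℚ (λ i → sumℚ (λ l → a i * (c l * W l i)))
    ≡⟨ sum-swap (λ i l → a i * (c l * W l i)) ⟩
  sumℚ (λ l → sumℚ (λ i → a i * (c l * W l i)))
    ≡⟨ sum-cong (λ l → trans (sum-cong λ i → a i * (c l * W l i) ≡ c l * (a i * W l i) ∋
          solve 3 (λ a b c → a :* (b :* c) := b :* (a :* c)) refl (a i) (c l) (W l i))
                             (sum-* (c l) (λ i → a i * W l i))) ⟩
  sumℚ (λ l → c l * ⟨ a , W l ⟩) ∎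
  where
  open ≡-Reasoning

dot-pos : ∀ {n} {e : Pt n} → ∃[ i ] e i ≢ 0ℚ → 0ℚ < ⟨ e , e ⟩
dot-pos {e = e} (i , p) = sum-pos {f = λ i → e i * e i} (λ i → 0≤sq (e i)) (i , 0<sq p)

LinInd : ∀ {k n} → (Fin k → Pt n) → Set
LinInd {k} W = (c : Fin k → ℚ) → lincomb c W ≐ (λ _ → 0ℚ) → ∀ l → c l ≡ 0ℚ

-- Gaussian elimination: a row with nonzero first entry serves as pivot and clears the first column
-- of the other rows; the smaller system is solved recursively.
kernel : ∀ k n → k ℕ.< n → (M : Fin k → Pt n) →
         Σ (Pt n) λ e → (∃[ i ] e i ≢ 0ℚ) × (∀ l → ⟨ M l , e ⟩ ≡ 0ℚ)
kernel zero    (suc n) _ M = (λ _ → 1ℚ) , (zero , λ ()) , λ ()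
kernel (suc k) (suc n) (s<s k<n) M with Fin.any? (λ l → ¬? (M l zero ≟ 0ℚ))
-- The first column vanishes, so the first unit vector solves the system.
... | no ¬p = (1ℚ ∷ (λ _ → 0ℚ)) , (zero , λ ()) , λ l →
  0≡+ (trans (*-identityʳ (M l zero)) (decidable-stable (M l zero ≟ 0ℚ) (λ q → ¬p (l , q))))
      (dot-0ʳ (λ i → M l (suc i)) (λ _ → refl))
... | yes (l , Ml≢0) with recip (M l zero) Ml≢0
... | s , Ms≡1 = go (kernel k n k<n M′)
  where
  open ≡-Reasoning
  r : Fin k → ℚ
  r x = - (M (punchIn l x) zero * s)
  M′ : Fin k → Pt n
  M′ x = axpy (M (punchIn l x) ∘ suc) (r x) (M l ∘ suc)
  go : (Σ (Pt n) λ e → (∃[ i ] e i ≢ 0ℚ) × (∀ x → ⟨ M′ x , e ⟩ ≡ 0ℚ)) →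
       Σ (Pt (suc n)) λ e → (∃[ i ] e i ≢ 0ℚ) × (∀ l → ⟨ M l , e ⟩ ≡ 0ℚ)
  -- Back substitution: the new first coordinate is the one that solves the pivot row.
  go (e , (i , ei≢0) , Me≡0) = (- (s * D) ∷ e) , (suc i , ei≢0) , zeros
    where
    D = ⟨ M l ∘ suc , e ⟩
    row : ∀ x → ⟨ M (punchIn l x) , - (s * D) ∷ e ⟩ ≡ 0ℚ
    row x = begin
      M (punchIn l x) zero * - (s * D) + ⟨ M (punchIn l x) ∘ suc , e ⟩
        ≡⟨ solve 4 (λ a b c d → a :* (:- (b :* c)) :+ d := d :+ (:- (a :* b)) :* c)
             refl (M (punchIn l x) zero) s D (⟨ (M (punchIn l x) ∘ suc) , e ⟩) ⟩
      ⟨ M (punchIn l x) ∘ suc , e ⟩ + - (M (punchIn l x) zero * s) * D       ≡⟨ dot-axpyˡ (M (punchIn l x) ∘ suc) (r x) (M l ∘ suc) e ⟨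
      ⟨ M′ x , e ⟩                                                           ≡⟨ Me≡0 x ⟩
      0ℚ ∎
    zeros : ∀ l′ → ⟨ M l′ , - (s * D) ∷ e ⟩ ≡ 0ℚ
    zeros l′ with l Fin.≟ l′
    ... | yes refl = begin
      M l zero * - (s * D) + D
        ≡⟨ solve 3 (λ a b c → a :* (:- (b :* c)) :+ c := c :- a :* b :* c) refl (M l′ zero) s D ⟩
      D - (M l zero * s) * D     ≡⟨ cong (λ u → D - u * D) Ms≡1 ⟩
      D - 1ℚ * D                 ≡⟨ solve 1 (λ a → a :- con 1ℚ :* a := con 0ℚ) refl D ⟩
      0ℚ                         ∎
    ... | no l≢l′ = subst (λ l″ → ⟨ M l″ , - (s * D) ∷ e ⟩ ≡ 0ℚ) (Fin.punchIn-punchOut l≢l′) (row (punchOut l≢l′))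

-- Pairing a vanishing combination with `e` isolates the coefficient of `W zero`, which is therefore
-- `0`; what remains is a relation among the independent vectors of the tail.
LinInd-extend : ∀ {k n} (W : Fin (suc k) → Pt n) (e : Pt n) → LinInd (W ∘ suc) →
                (∀ l → ⟨ e , W (suc l) ⟩ ≡ 0ℚ) → ⟨ e , W zero ⟩ ≢ 0ℚ → LinInd W
LinInd-extend W e ind e⊥W eW₀ c cW≡0 = λ { zero → c₀≡0 ; (suc l) → ind (c ∘ suc) rest l }
  where
  open ≡-Reasoning
  c₀·eW₀ : ⟨ e , W zero ⟩ * c zero ≡ 0ℚ
  c₀·eW₀ = begin
    ⟨ e , W zero ⟩ * c zero
      ≡⟨ solve 2 (λ a b → a :* b := b :* a :+ con 0ℚ) refl (⟨ e , W zero ⟩) (c zero) ⟩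
    c zero * ⟨ e , W zero ⟩ + 0ℚ      ≡⟨ cong (c zero * ⟨ e , W zero ⟩ +_)
                                          (sum-0 (λ l → 0≡* (c (suc l)) (e⊥W l))) ⟨
    sumℚ (λ l → c l * ⟨ e , W l ⟩)    ≡⟨ dot-lincomb e c W ⟨
    ⟨ e , lincomb c W ⟩               ≡⟨ dot-0ʳ e cW≡0 ⟩
    0ℚ ∎
  c₀≡0 : c zero ≡ 0ℚ
  c₀≡0 = *≡0 c₀·eW₀ eW₀
  rest : lincomb (c ∘ suc) (W ∘ suc) ≐ (λ _ → 0ℚ)
  rest i = ≡-by (0≡+ (cW≡0 i) (0≡* (- W zero i) c₀≡0))
    (c zero * W zero i + lincomb (c ∘ suc) (W ∘ suc) i + - W zero i * c zero
       ≡ lincomb (c ∘ suc) (W ∘ suc) i - 0ℚ ∋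
             solve 3 (λ a b c → a :* b :+ c :+ (:- b) :* a := c :- con 0ℚ)
               refl (c zero) (W zero i) (lincomb (c ∘ suc) (W ∘ suc) i))

-- Otherwise e could be added to W, giving n + 1 independent vectors.
orthogonal-to-basis : ∀ {n} {W : Fin n → Pt n} → LinInd W → (e : Pt n) →
                      (∀ l → ⟨ e , W l ⟩ ≡ 0ℚ) → ∀ i → e i ≡ 0ℚ
orthogonal-to-basis {n} {W} ind e e⊥W i = decidable-stable (e i ≟ 0ℚ) λ ei≢0 →
  -- The matrix is transposed: its `n` rows list the coordinates of the `n + 1` vectors, so a kernel
  -- vector is a linear relation between these vectors.
  let c , (j , cj≢0) , ker = kernel n (suc n) (ℕ.n<1+n n) (λ i → e i ∷ (λ l → W l i))
      eW = LinInd-extend (e ∷ W) e ind e⊥W (<-absurd (dot-pos {e = e} (i , ei≢0)))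
  in cj≢0 (eW c (λ i → trans (cong₂ _+_ (*-comm (c zero) (e i)) (sum-cong (λ l → *-comm (c (suc l)) (W l i)))) (ker i)) j)

-- Farkas' lemma and facets

Cone : ∀ {m n} → (Fin m → Pt n) → Pt n → Set
Cone {m} g p = Σ (Fin m → ℚ) λ c → (∀ l → 0ℚ ≤ c l) × p ≐ lincomb c g

Farkas : ∀ {m n} → (Fin m → Pt n) → Pt n → Set
Farkas {m} {n} g p = Cone g p ⊎ Σ (Pt n) λ a → (∀ l → 0ℚ ≤ ⟨ a , g l ⟩) × ⟨ a , p ⟩ < 0ℚ

-- Since `s` is `-1 / ⟨ a , g zero ⟩`, the map `proj` is the projection along `g zero` onto the
-- kernel of `a`. A cone representation is lifted by adding a multiple of `g zero`; a separating
-- functional `b` is pulled back to `b ∘ proj`, which vanishes on `g zero`.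
farkas-project : ∀ {m n} (g : Fin (suc m) → Pt n) (p a : Pt n) (s : ℚ) →
  (∀ l → 0ℚ ≤ ⟨ a , g (suc l) ⟩) → ⟨ a , p ⟩ < 0ℚ → 0ℚ < s → - ⟨ a , g zero ⟩ * s ≡ 1ℚ →
  let proj = λ x → axpy x (⟨ a , x ⟩ * s) (g zero) in
  Farkas (λ l → proj (g (suc l))) (proj p) → Farkas g p
farkas-project {m} {n} g p a s 0≤a ap<0 0<s -ag₀s≡1 = go
  where
  open ≡-Reasoning
  proj : Pt n → Pt n
  proj x = axpy x (⟨ a , x ⟩ * s) (g zero)
  t = ⟨ a , p ⟩ * s
  0≤-t : 0ℚ ≤ - t
  0≤-t = ≤-by (0≤* (<⇒≤ (<0⇒0<- ap<0)) (<⇒≤ 0<s)) (- ⟨ a , p ⟩ * s ≡ - (⟨ a , p ⟩ * s) - 0ℚ ∋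
        solve 2 (λ a b → (:- a) :* b := (:- (a :* b)) :- con 0ℚ) refl (⟨ a , p ⟩) s)
  go : Farkas (proj ∘ g ∘ suc) (proj p) → Farkas g p
  -- `S` collects the multiples of `g zero` that `proj` added to the generators, and `t` is the
  -- multiple that it added to `p`. As `⟨ a , p ⟩ < 0`, subtracting `t` keeps the coefficient
  -- nonnegative.
  go (inj₁ (c , 0≤c , eq)) = inj₁ ((S - t) ∷ c , nonneg , comb)
    where
    S = sumℚ (λ l → c l * (⟨ a , g (suc l) ⟩ * s))
    nonneg : ∀ l → 0ℚ ≤ ((S - t) ∷ c) l
    nonneg zero = 0≤+ {S} { - t} (sum-nonneg (λ l → 0≤* (0≤c l) (0≤* (0≤a l) (<⇒≤ 0<s)))) 0≤-t
    nonneg (suc l) = 0≤c l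
    comb : ∀ i → p i ≡ (S - t) * g zero i + lincomb c (g ∘ suc) i
    comb i = begin
      p i ≡⟨ solve 3 (λ a b c → a := a :+ b :* c :- b :* c) refl (p i) t (g zero i) ⟩
      (p i + t * g zero i) - t * g zero i
        ≡⟨ cong (_- t * g zero i) (eq i) ⟩
      sumℚ (λ l → c l * (g (suc l) i + ⟨ a , g (suc l) ⟩ * s * g zero i)) - t * g zero i
        ≡⟨ cong (_- t * g zero i) (trans
             (sum-cong λ l → c l * (g (suc l) i + ⟨ a , g (suc l) ⟩ * s * g zero i)
                               ≡ c l * g (suc l) i + g zero i * (c l * (⟨ a , g (suc l) ⟩ * s)) ∋
                                     solve 5 (λ a b c d e → a :* (b :+ c :* d :* e) := a :* b :+ e :* (a :* (c :* d)))
                                       refl (c l) (g (suc l) i) (⟨ a , g (suc l) ⟩) s (g zero i))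
             (sum-+* (λ l → c l * g (suc l) i) (g zero i) (λ l → c l * (⟨ a , g (suc l) ⟩ * s)))) ⟩
      lincomb c (g ∘ suc) i + g zero i * S - t * g zero i
        ≡⟨ solve 4 (λ a b c d → a :+ b :* c :- d :* b := (c :- d) :* b :+ a)
              refl (lincomb c (g ∘ suc) i) (g zero i) S t ⟩
      (S - t) * g zero i + lincomb c (g ∘ suc) i ∎
  go (inj₂ (b , 0≤b , bp<0)) = inj₂ (axpy b r a , nonneg , subst (_< 0ℚ) (sym (move p)) bp<0)
    where
    bg = ⟨ b , g zero ⟩
    ag = ⟨ a , g zero ⟩
    r = bg * s
    move : ∀ x → ⟨ axpy b r a , x ⟩ ≡ ⟨ b , proj x ⟩
    move x = begin
      ⟨ axpy b r a , x ⟩              ≡⟨ dot-axpyˡ b r a x ⟩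
      ⟨ b , x ⟩ + bg * s * ⟨ a , x ⟩
        ≡⟨ solve 4 (λ a b c d → a :+ b :* c :* d := a :+ d :* c :* b) refl (⟨ b , x ⟩) bg s (⟨ a , x ⟩) ⟩
      ⟨ b , x ⟩ + ⟨ a , x ⟩ * s * bg  ≡⟨ dot-axpyʳ b x (⟨ a , x ⟩ * s) (g zero) ⟨
      ⟨ b , proj x ⟩ ∎
    nonneg : ∀ l → 0ℚ ≤ ⟨ axpy b r a , g l ⟩
    nonneg (suc l) = subst (0ℚ ≤_) (sym (move (g (suc l)))) (0≤b l)
    nonneg zero = ≤-reflexive (sym (begin
      ⟨ axpy b r a , g zero ⟩         ≡⟨ dot-axpyˡ b r a (g zero) ⟩
      bg + bg * s * ag
        ≡⟨ solve 3 (λ a b c → a :+ a :* b :* c := a :- a :* ((:- c) :* b)) refl bg s ag ⟩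
      bg - bg * (- ag * s)            ≡⟨ cong (λ u → bg - bg * u) -ag₀s≡1 ⟩
      bg - bg * 1ℚ                    ≡⟨ solve 1 (λ a → a :- a :* con 1ℚ := con 0ℚ) refl bg ⟩
      0ℚ ∎))

-- Induction on the number of generators: if the functional a obtained for the tail is
-- negative on the head g₀, project the tail and p along g₀ onto the hyperplane a = 0.
farkas : ∀ {m n} (g : Fin m → Pt n) (p : Pt n) →
         Farkas g p
farkas {zero} g p with Fin.any? (λ i → ¬? (p i ≟ 0ℚ))
... | no ¬q = inj₁ ((λ ()) , (λ ()) , λ i → decidable-stable (p i ≟ 0ℚ) (λ q → ¬q (i , q)))
... | yes q = inj₂ ((λ i → - p i) , (λ ()) , <-by (dot-pos {e = p} q) (begin
  ⟨ p , p ⟩                              ≡⟨ solve 1 (λ a → a := con 0ℚ :- (:- con 1ℚ) :* a) refl (⟨ p , p ⟩) ⟩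
  0ℚ - (- 1ℚ) * ⟨ p , p ⟩                ≡⟨ cong (λ u → 0ℚ - u) (sum-* (- 1ℚ) (λ i → p i * p i)) ⟨
  0ℚ - sumℚ (λ i → - 1ℚ * (p i * p i))   ≡⟨ cong (λ u → 0ℚ - u) (sum-cong λ i → - 1ℚ * (p i * p i) ≡ - p i * p i ∋
        solve 1 (λ a → (:- con 1ℚ) :* (a :* a) := (:- a) :* a) refl (p i)) ⟩
  0ℚ - ⟨ (λ i → - p i) , p ⟩             ∎))
  where
  open ≡-Reasoning
farkas {suc m} g p with farkas (g ∘ suc) p
... | inj₁ (c , 0≤c , eq) =
  inj₁ ((0ℚ ∷ c) , (λ { zero → ≤-refl ; (suc l) → 0≤c l }) ,
        λ i → trans (eq i) (lincomb c (g ∘ suc) i ≡ 0ℚ * g zero i + lincomb c (g ∘ suc) i ∋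
              solve 2 (λ a b → a := con 0ℚ :* b :+ a) refl (lincomb c (g ∘ suc) i) (g zero i)))
... | inj₂ (a , 0≤a , ap<0) = case 0ℚ ≤? ⟨ a , g zero ⟩ of λ where
  (yes 0≤ag₀) → inj₂ (a , (λ { zero → 0≤ag₀ ; (suc l) → 0≤a l }) , ap<0)
  (no ag₀≱0) → case recip-pos (- ⟨ a , g zero ⟩) (<0⇒0<- (≰⇒> ag₀≱0)) of λ where
    (s , 0<s , eq) → farkas-project g p a s 0≤a ap<0 0<s eq
      (farkas (λ l → axpy (g (suc l)) (⟨ a , g (suc l) ⟩ * s) (g zero)) (axpy p (⟨ a , p ⟩ * s) (g zero)))

-- t is the first zero of the affine functions α l + t β l on t ≥ 0, attained at l = k.
min-ratio : ∀ {m} (α β : Fin m → ℚ) → (∀ l → 0ℚ ≤ α l) →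
  (∀ l → 0ℚ ≤ β l) ⊎
  (∃[ t ] ∃[ k ] (0ℚ ≤ t × β k < 0ℚ × α k + t * β k ≡ 0ℚ × (∀ l → 0ℚ ≤ α l + t * β l)))
min-ratio {zero}  α β 0≤α = inj₁ λ ()
min-ratio {suc m} α β 0≤α = case 0ℚ ≤? β zero of λ where
    (yes 0≤β₀) → case rest of λ where
      (inj₁ 0≤β) → inj₁ λ { zero → 0≤β₀ ; (suc l) → 0≤β l }
      (inj₂ (t , k , 0≤t , βk<0 , eq , 0≤)) → inj₂ (t , suc k , 0≤t , βk<0 , eq ,
        λ { zero → 0≤+ (0≤α zero) (0≤* 0≤t 0≤β₀) ; (suc l) → 0≤ l })
    (no β₀≱0) → negative-head rest (≰⇒> β₀≱0) (recip-pos (- β zero) (<0⇒0<- (≰⇒> β₀≱0)))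
  where
  open ≡-Reasoning
  Goal = (∀ l → 0ℚ ≤ β l) ⊎
    (∃[ t ] ∃[ k ] (0ℚ ≤ t × β k < 0ℚ × α k + t * β k ≡ 0ℚ × (∀ l → 0ℚ ≤ α l + t * β l)))
  Rest = (∀ l → 0ℚ ≤ β (suc l)) ⊎
    (∃[ t ] ∃[ k ] (0ℚ ≤ t × β (suc k) < 0ℚ × α (suc k) + t * β (suc k) ≡ 0ℚ ×
      (∀ l → 0ℚ ≤ α (suc l) + t * β (suc l))))
  rest : Rest
  rest = min-ratio (α ∘ suc) (β ∘ suc) (0≤α ∘ suc)
  negative-head : Rest → β zero < 0ℚ → ∃[ s ] (0ℚ < s × - β zero * s ≡ 1ℚ) → Goal
  negative-head r β₀<0 (s , 0<s , eq) = case r of λ where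
      (inj₁ 0≤β) → head-first λ l → 0≤+ (0≤α (suc l)) (0≤* 0≤t₀ (0≤β l))
      -- The head vanishes at `t₀` and the tail has its first zero at `t`; the earlier of the two is
      -- the answer.
      (inj₂ (t , k , 0≤t , βk<0 , eqt , 0≤)) → case ≤-total t₀ t of λ where
        (inj₁ t₀≤t) → head-first λ l → case ≤-total 0ℚ (β (suc l)) of λ where
          (inj₁ 0≤βl) → 0≤+ (0≤α (suc l)) (0≤* 0≤t₀ 0≤βl)
          (inj₂ βl≤0) → ≤-by (0≤+ (0≤ l) (0≤* (0≤- t₀≤t) (0≤- βl≤0)))
            (α (suc l) + t * β (suc l) + (t - t₀) * (0ℚ - β (suc l)) ≡ α (suc l) + t₀ * β (suc l) - 0ℚ ∋
                  solve 4 (λ a b c d → a :+ b :* c :+ (b :- d) :* (con 0ℚ :- c) := a :+ d :* c :- con 0ℚ)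
                    refl (α (suc l)) t (β (suc l)) t₀)
        (inj₂ t≤t₀) → inj₂ (t , suc k , 0≤t , βk<0 , eqt , λ where
          zero → ≤-by (0≤+ (≤-reflexive (sym zero₀)) (0≤* (0≤- t≤t₀) (<⇒≤ (0<- β₀<0))))
            (α zero + t₀ * β zero + (t₀ - t) * (0ℚ - β zero) ≡ α zero + t * β zero - 0ℚ ∋
                  solve 4 (λ a b c d → a :+ b :* c :+ (b :- d) :* (con 0ℚ :- c) := a :+ d :* c :- con 0ℚ)
                    refl (α zero) t₀ (β zero) t)
          (suc l) → 0≤ l)
    where
    t₀ = α zero * s
    0≤t₀ : 0ℚ ≤ t₀
    0≤t₀ = 0≤* (0≤α zero) (<⇒≤ 0<s)
    zero₀ : α zero + t₀ * β zero ≡ 0ℚ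
    zero₀ = begin
      α zero + α zero * s * β zero
        ≡⟨ solve 3 (λ a b c → a :+ a :* b :* c := a :* (con 1ℚ :- (:- c) :* b)) refl (α zero) s (β zero) ⟩
      α zero * (1ℚ - - β zero * s)       ≡⟨ cong (λ u → α zero * (1ℚ - u)) eq ⟩
      α zero * (1ℚ - 1ℚ)                 ≡⟨ solve 1 (λ a → a :* (con 1ℚ :- con 1ℚ) := con 0ℚ) refl (α zero) ⟩
      0ℚ ∎
    head-first : (∀ l → 0ℚ ≤ α (suc l) + t₀ * β (suc l)) → Goal
    head-first 0≤ = inj₂ (t₀ , zero , 0≤t₀ , β₀<0 , zero₀ ,
      λ { zero → ≤-reflexive (sym zero₀) ; (suc l) → 0≤ l })

-- Turning a separating functional onto a facet

dot-neg : ∀ {n} (e x : Pt n) → ⟨ (λ i → - e i) , x ⟩ ≡ - ⟨ e , x ⟩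
dot-neg e x = begin
  ⟨ (λ i → - e i) , x ⟩                ≡⟨ sum-cong (λ i → - e i * x i ≡ - 1ℚ * (e i * x i) ∋
        solve 2 (λ a b → (:- a) :* b := (:- con 1ℚ) :* (a :* b)) refl (e i) (x i)) ⟩
  sumℚ (λ i → - 1ℚ * (e i * x i))      ≡⟨ sum-* (- 1ℚ) (λ i → e i * x i) ⟩
  - 1ℚ * ⟨ e , x ⟩                     ≡⟨ solve 1 (λ a → (:- con 1ℚ) :* a := :- a) refl (⟨ e , x ⟩) ⟩
  - ⟨ e , x ⟩ ∎
  where open ≡-Reasoning

-- Spanning is expressed dually, through functionals; this is the form that `orthogonal-to-basis`
-- provides and that `turn` needs.
Spanning : ∀ {m n} → (Fin m → Pt n) → Set
Spanning {m} {n} g = ∀ (e : Pt n) → (∀ l → ⟨ e , g l ⟩ ≡ 0ℚ) → ∀ i → e i ≡ 0ℚ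

-- A state of the turning process: a functional that separates `p` from the cone, together with `k`
-- independent generators in its kernel. For spanning generators and `k = n - 1` the kernel supports
-- a facet of the cone.
record TightFunctional {m n} (g : Fin m → Pt n) (p : Pt n) (k : ℕ) : Set where
  field
    normal : Pt n
    0≤ag   : ∀ l → 0ℚ ≤ ⟨ normal , g l ⟩
    ap<0   : ⟨ normal , p ⟩ < 0ℚ
    tight  : Fin k → Fin m
    indep  : LinInd (g ∘ tight)
    ag≡0   : ∀ x → ⟨ normal , g (tight x) ⟩ ≡ 0ℚ

open TightFunctional

-- The normal is turned around its tight generators, in a direction orthogonal to p, until the
-- next generator becomes tight.
turn : ∀ {m n} {g : Fin m → Pt n} {p : Pt n} → Spanning g → ∀ {k} → suc k ℕ.< n →
       TightFunctional g p k → TightFunctional g p (suc k)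
turn {m} {n} {g} {p} span {k} k<n A = turned (direction (kernel (suc k) n k<n (p ∷ g ∘ tight A)))
  where
  open ≡-Reasoning
  Direction = Σ (Pt n) λ e → ⟨ e , p ⟩ ≡ 0ℚ × (∀ x → ⟨ e , g (tight A x) ⟩ ≡ 0ℚ) × (∃[ l ] ⟨ e , g l ⟩ < 0ℚ)
  direction : (Σ (Pt n) λ e → (∃[ i ] e i ≢ 0ℚ) × (∀ x → ⟨ (p ∷ g ∘ tight A) x , e ⟩ ≡ 0ℚ)) → Direction
  -- As the generators span, `e` is nonzero on one of them. The sign is chosen so that `e` is
  -- negative there; otherwise the turning might never stop.
  direction (e , (i , ei≢0) , ⊥e) = case Fin.any? (λ l → ¬? (⟨ e , g l ⟩ ≟ 0ℚ)) of λ where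
      (no ¬q) → contradiction (span e (λ l → decidable-stable (⟨ e , g l ⟩ ≟ 0ℚ) (λ q → ¬q (l , q))) i) ei≢0
      (yes (l , eg≢0)) → case ≢0⇒<0∨>0 eg≢0 of λ where
        (inj₁ eg<0) → e , e⊥ zero , e⊥ ∘ suc , l , eg<0
        (inj₂ 0<eg) → (λ j → - e j) , trans (dot-neg e p) (cong -_ (e⊥ zero)) ,
          (λ x → trans (dot-neg e (g (tight A x))) (cong -_ (e⊥ (suc x)))) , l ,
          <-by 0<eg (begin
            ⟨ e , g l ⟩           ≡⟨ solve 1 (λ a → a := con 0ℚ :- (:- a)) refl (⟨ e , g l ⟩) ⟩
            0ℚ - - ⟨ e , g l ⟩    ≡⟨ cong (λ u → 0ℚ - u) (dot-neg e (g l)) ⟨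
            0ℚ - ⟨ (λ j → - e j) , g l ⟩ ∎)
    where
    e⊥ : ∀ x → ⟨ e , (p ∷ g ∘ tight A) x ⟩ ≡ 0ℚ
    e⊥ x = trans (dot-comm e ((p ∷ g ∘ tight A) x)) (⊥e x)
  turned : Direction → TightFunctional g p (suc k)
  turned (e , ep≡0 , eT≡0 , l₀ , egl₀<0) =
    case min-ratio (λ l → ⟨ normal A , g l ⟩) (λ l → ⟨ e , g l ⟩) (0≤ag A) of λ where
      (inj₁ 0≤eg) → ⊥-elim (<-irrefl refl (≤-<-trans (0≤eg l₀) egl₀<0))
      (inj₂ (t , z , 0≤t , egz<0 , eq , 0≤)) → let dot = λ x → dot-axpyˡ (normal A) t e x in record
        { normal = axpy (normal A) t e
        ; 0≤ag = λ l → subst (0ℚ ≤_) (sym (dot (g l))) (0≤ l)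
        ; ap<0 = subst (_< 0ℚ) (sym (begin
            ⟨ axpy (normal A) t e , p ⟩        ≡⟨ dot p ⟩
            ⟨ normal A , p ⟩ + t * ⟨ e , p ⟩   ≡⟨ cong (λ u → ⟨ normal A , p ⟩ + t * u) ep≡0 ⟩
            ⟨ normal A , p ⟩ + t * 0ℚ
              ≡⟨ solve 2 (λ a b → a :+ b :* con 0ℚ := a) refl (⟨ normal A , p ⟩) t ⟩
            ⟨ normal A , p ⟩                   ∎)) (ap<0 A)
        ; tight = z ∷ tight A
        -- The direction `e` vanishes on the old tight generators but is negative on the new one, so
        -- the new one is independent of them.
        ; indep = LinInd-extend (g ∘ (z ∷ tight A)) e (indep A) eT≡0 (λ q → <-irrefl q egz<0)
        ; ag≡0 = λ where
            zero → trans (dot (g z)) eq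
            (suc x) → trans (dot (g (tight A x))) (0≡+ (ag≡0 A x) (0≡* t (eT≡0 x))) }

turn-to-facet : ∀ {m n} {g : Fin m → Pt n} {p : Pt n} → Spanning g →
  TightFunctional g p 0 → ∀ k → k ℕ.< n → TightFunctional g p k
turn-to-facet span A zero    _   = A
turn-to-facet span A (suc k) k<n = turn span k<n (turn-to-facet span A k (ℕ.<-trans (ℕ.n<1+n k) k<n))

-- x ↦ x + (1, …, 1) makes affine functions on V linear and affine independence linear independence.
hat : ∀ {n} → Pt n → Pt n
hat x i = x i + 1ℚ

𝟙 : ∀ {n} → Pt n
𝟙 _ = 1ℚ

0<sum-𝟙 : ∀ d → 0ℚ < sumℚ (𝟙 {suc d})
0<sum-𝟙 d = 0<+ 0<1 (sum-nonneg {d} (λ _ → 0≤1))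

dot-hat : ∀ {n} (a x : Pt n) → ⟨ a , hat x ⟩ ≡ ⟨ a , x ⟩ + sumℚ a
dot-hat a x = trans (sum-cong λ i → a i * (x i + 1ℚ) ≡ a i * x i + a i ∋
      solve 2 (λ a b → a :* (b :+ con 1ℚ) := a :* b :+ a) refl (a i) (x i)) (sum-+ (λ i → a i * x i) a)

sum-lincomb : ∀ {m n} (c : Fin m → ℚ) (W : Fin m → Pt n) → sumℚ (lincomb c W) ≡ sumℚ (λ l → c l * sumℚ (W l))
sum-lincomb c W = trans (sum-swap (λ i l → c l * W l i)) (sum-cong (λ l → sum-* (c l) (W l)))

lincomb-hat : ∀ {m n} (c : Fin m → ℚ) (W : Fin m → Pt n) i →
              lincomb c (hat ∘ W) i ≡ lincomb c W i + sumℚ c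
lincomb-hat c W i = trans (sum-cong λ l → c l * (W l i + 1ℚ) ≡ c l * W l i + c l ∋
      solve 2 (λ a b → a :* (b :+ con 1ℚ) := a :* b :+ a) refl (c l) (W l i))
                          (sum-+ (λ l → c l * W l i) c)

lincomb-InV : ∀ {m n} (c : Fin m → ℚ) (W : Fin m → Pt n) → (∀ l → InV (W l)) → InV (lincomb c W)
lincomb-InV c W inV = trans (sum-lincomb c W) (sum-0 (λ l → 0≡* (c l) (inV l)))

sum-hat : ∀ {n} (x : Pt n) → InV x → sumℚ (hat x) ≡ sumℚ (𝟙 {n})
sum-hat {n} x inV = begin
  sumℚ (hat x)           ≡⟨ sum-+ x 𝟙 ⟩
  sumℚ x + sumℚ (𝟙 {n})  ≡⟨ cong (_+ sumℚ (𝟙 {n})) inV ⟩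
  0ℚ + sumℚ (𝟙 {n})      ≡⟨ +-identityˡ (sumℚ (𝟙 {n})) ⟩
  sumℚ (𝟙 {n}) ∎
  where open ≡-Reasoning

-- For points of `V` every lifted vector has the same positive coordinate sum, so a vanishing
-- combination of lifted vectors has coefficients that sum to `0`.
AffInd⇒LinInd : ∀ {k d} (W : Fin k → Pt (suc d)) → (∀ l → InV (W l)) → AffInd W → LinInd (hat ∘ W)
AffInd⇒LinInd {k} {d} W inV ind c cŴ≡0 = ind c sum≡0 λ i →
  ≡-by (0≡+ (trans (sym (lincomb-hat c W i)) (cŴ≡0 i)) (0≡* (- 1ℚ) sum≡0))
    (lincomb c W i + sumℚ c + - 1ℚ * sumℚ c ≡ lincomb c W i - 0ℚ ∋
          solve 2 (λ a b → a :+ b :+ (:- con 1ℚ) :* b := a :- con 0ℚ) refl (lincomb c W i) (sumℚ c))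
  where
  open ≡-Reasoning
  N = sumℚ (𝟙 {suc d})
  sum≡0 : sumℚ c ≡ 0ℚ
  sum≡0 = *≡0 (begin
    N * sumℚ c                           ≡⟨ sum-* N c ⟨
    sumℚ (λ l → N * c l)                 ≡⟨ sum-cong (λ l → trans (*-comm N (c l)) (cong (c l *_) (sym (sum-hat (W l) (inV l))))) ⟩
    sumℚ (λ l → c l * sumℚ (hat (W l)))  ≡⟨ sum-lincomb c (hat ∘ W) ⟨
    sumℚ (lincomb c (hat ∘ W))           ≡⟨ sum-0 cŴ≡0 ⟩
    0ℚ ∎) (<-absurd (0<sum-𝟙 d))

LinInd⇒AffInd : ∀ {k n} (W : Fin k → Pt n) → LinInd (hat ∘ W) → AffInd W
LinInd⇒AffInd W ind c sum≡0 cW≡0 = ind c (λ i → trans (lincomb-hat c W i) (0≡+ (cW≡0 i) sum≡0))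

hat-Conv : ∀ {m n} {vs : Fin m → Pt n} {x : Pt n} ((c , _) : Conv vs x) → hat x ≐ lincomb c (hat ∘ vs)
hat-Conv {vs = vs} (c , _ , sum≡1 , x≐) i =
  trans (cong₂ _+_ (x≐ i) (sym sum≡1)) (sym (lincomb-hat c vs i))

Conv-InV : ∀ {m n} {vs : Fin m → Pt n} → (∀ l → InV (vs l)) → ∀ {x} → Conv vs x → InV x
Conv-InV {vs = vs} inV (c , _ , _ , x≐) = trans (sum-cong x≐) (lincomb-InV c vs inV)

Conv-vertex : ∀ {m n} (vs : Fin m → Pt n) l → Conv vs (vs l)
Conv-vertex {suc m} vs zero = (1ℚ ∷ (λ _ → 0ℚ)) , (λ { zero → 0≤1 ; (suc l) → ≤-refl }) ,
  cong (1ℚ +_) (sum-0 {m} (λ _ → refl)) , λ i → sym (begin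
    1ℚ * vs zero i + sumℚ (λ l → 0ℚ * vs (suc l) i) ≡⟨ cong (1ℚ * vs zero i +_) (sum-0 (λ l → *-zeroˡ (vs (suc l) i))) ⟩
    1ℚ * vs zero i + 0ℚ   ≡⟨ solve 1 (λ a → con 1ℚ :* a :+ con 0ℚ := a) refl (vs zero i) ⟩
    vs zero i ∎)
  where open ≡-Reasoning
Conv-vertex {suc m} vs (suc l) = let c , 0≤c , s , x≐ = Conv-vertex (vs ∘ suc) l in
  (0ℚ ∷ c) , (λ { zero → ≤-refl ; (suc l) → 0≤c l }) , trans (+-identityˡ (sumℚ c)) s ,
  λ i → trans (x≐ i) (lincomb c (vs ∘ suc) i ≡ 0ℚ * vs zero i + lincomb c (vs ∘ suc) i ∋
        solve 2 (λ a b → a := con 0ℚ :* b :+ a)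
          refl (lincomb (proj₁ (Conv-vertex (vs ∘ suc) l)) (vs ∘ suc) i) (vs zero i))

-- Farkas' lemma is applied to the lifted vertices and the lifted `p`. Comparing coordinate sums
-- shows that a cone representation is a convex one; a separating functional is turned until `d`
-- independent lifted vertices are tight, which makes it a facet.
facet-separation : ∀ {m d} (vs : Fin m → Pt (suc d)) → (∀ l → InV (vs l)) → FullDimInV (Polytope vs) →
  (p : Pt (suc d)) → InV p →
  Conv vs p ⊎ Σ (Pt (suc d)) λ a → Σ ℚ λ b → FacetDefining (Polytope vs) a b × b < ⟨ a , p ⟩
facet-separation {m} {d} vs inV (W , W∈P , ind) p p∈V = case farkas (hat ∘ vs) (hat p) of λ where
    (inj₁ (c , 0≤c , eq)) → inj₁ (inside c 0≤c eq)
    (inj₂ (a , 0≤a , ap<0)) → inj₂ (outside (turn-to-facet span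
      (record { normal = a ; 0≤ag = 0≤a ; ap<0 = ap<0 ; tight = λ () ; indep = λ _ _ () ; ag≡0 = λ () })
      d (ℕ.n<1+n d)))
  where
  open ≡-Reasoning
  N = sumℚ (𝟙 {suc d})
  inside : ∀ c → (∀ l → 0ℚ ≤ c l) → hat p ≐ lincomb c (hat ∘ vs) → Conv vs p
  inside c 0≤c eq = c , 0≤c , sum≡1 , λ i →
    ≡-by (0≡+ (0≡- (trans (eq i) (lincomb-hat c vs i))) (0≡- sum≡1))
      (p i + 1ℚ - (lincomb c vs i + sumℚ c) + (sumℚ c - 1ℚ) ≡ p i - lincomb c vs i ∋
            solve 3 (λ a b c → a :+ con 1ℚ :- (b :+ c) :+ (c :- con 1ℚ) := a :- b)
              refl (p i) (lincomb c vs i) (sumℚ c))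
    where
    sum≡1 : sumℚ c ≡ 1ℚ
    sum≡1 = ≡-by (*≡0 (begin
      N * (sumℚ c - 1ℚ)
        ≡⟨ solve 2 (λ a b → a :* (b :- con 1ℚ) := a :* b :- a) refl N (sumℚ c) ⟩
      N * sumℚ c - N                          ≡⟨ cong (_- N) (sum-* N c) ⟨
      sumℚ (λ l → N * c l) - N                ≡⟨ cong (_- N) (sum-cong (λ l → trans (*-comm N (c l)) (cong (c l *_) (sym (sum-hat (vs l) (inV l)))))) ⟩
      sumℚ (λ l → c l * sumℚ (hat (vs l))) - N ≡⟨ cong (_- N) (sum-lincomb c (hat ∘ vs)) ⟨
      sumℚ (lincomb c (hat ∘ vs)) - N         ≡⟨ cong (_- N) (trans (sym (sum-cong eq)) (sum-hat p p∈V)) ⟩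
      N - N                                   ≡⟨ +-inverseʳ N ⟩
      0ℚ ∎) (<-absurd (0<sum-𝟙 d))) refl
  dot-hat-Conv : ∀ (e : Pt (suc d)) {x} ((c , _) : Conv vs x) → ⟨ e , hat x ⟩ ≡ sumℚ (λ l → c l * ⟨ e , hat (vs l) ⟩)
  dot-hat-Conv e x∈P@(c , _) = trans (dot-congʳ e (hat-Conv x∈P)) (dot-lincomb e c (hat ∘ vs))
  span : Spanning (hat ∘ vs)
  span e e⊥ = orthogonal-to-basis {W = hat ∘ W} (AffInd⇒LinInd W (λ l → Conv-InV inV (W∈P l)) ind) e λ l →
    trans (dot-hat-Conv e {W l} (W∈P l)) (sum-0 (λ k → 0≡* (proj₁ (W∈P l) k) (e⊥ k)))
  outside : TightFunctional (hat ∘ vs) (hat p) d →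
            Σ (Pt (suc d)) λ a → Σ ℚ λ b → FacetDefining (Polytope vs) a b × b < ⟨ a , p ⟩
  -- By `dot-hat`, nonnegativity of `⟨ e , hat x ⟩` is the affine inequality `- ⟨ e , x ⟩ ≤ sumℚ e`.
  outside A = (λ i → - e i) , sumℚ e , (nonconstant , bounded , vs ∘ tight A ,
      (λ x → Conv-vertex vs (tight A x) ,
             ≡-by (0≡* (- 1ℚ) (ag≡0 A x)) (trans (cong (- 1ℚ *_) (dot-hat e (vs (tight A x))))
               (trans (solve 2 (λ a b → (:- con 1ℚ) :* (a :+ b) := (:- a) :- b)
                     refl (⟨ e , vs (tight A x) ⟩) (sumℚ e)) (cong (_- sumℚ e) (sym (dot-neg e (vs (tight A x)))))))) ,
      LinInd⇒AffInd (vs ∘ tight A) (indep A)) ,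
    <-by (0<- (ap<0 A)) (trans (cong (λ u → 0ℚ - u) (dot-hat e p))
      (trans (solve 2 (λ a b → con 0ℚ :- (a :+ b) := (:- a) :- b)
            refl (⟨ e , p ⟩) (sumℚ e)) (cong (_- sumℚ e) (sym (dot-neg e p)))))
    where
    e = normal A
    0≤eP : ∀ {x} → Conv vs x → 0ℚ ≤ ⟨ e , hat x ⟩
    0≤eP x∈P@(c , 0≤c , _) = subst (0ℚ ≤_) (sym (dot-hat-Conv e x∈P)) (sum-nonneg (λ l → 0≤* (0≤c l) (0≤ag A l)))
    bounded : ∀ x → Conv vs x → ⟨ (λ i → - e i) , x ⟩ ≤ sumℚ e
    bounded x x∈P = ≤-by (0≤eP x∈P) (trans (dot-hat e x) (trans
          (solve 2 (λ a b → a :+ b := b :- (:- a))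
            refl (⟨ e , x ⟩) (sumℚ e)) (cong (λ u → sumℚ e - u) (sym (dot-neg e x)))))
    dot-constant : (∀ i → e i ≡ e zero) → ∀ x → InV x → ⟨ e , hat x ⟩ ≡ e zero * N
    dot-constant e≡ x x∈V = begin
      ⟨ e , hat x ⟩                          ≡⟨ sum-cong (λ i → cong (_* hat x i) (e≡ i)) ⟩
      sumℚ (λ i → e zero * hat x i)          ≡⟨ sum-* (e zero) (hat x) ⟩
      e zero * sumℚ (hat x)                  ≡⟨ cong (e zero *_) (sum-hat x x∈V) ⟩
      e zero * N ∎
    -- A constant normal would take equal values on `hat p` and `hat (W zero)`, but the first value
    -- is negative and the second is not.
    nonconstant : ∃[ i ] ∃[ j ] - e i ≢ - e j
    nonconstant = case Fin.any? (λ i → ¬? (e i ≟ e zero)) of λ where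
      (yes (i , ei≢e0)) → i , zero , λ q → ei≢e0 (neg-injective q)
      (no all≡) → let e≡ = λ i → decidable-stable (e i ≟ e zero) (λ q → all≡ (i , q)) in
        ⊥-elim (<-irrefl refl (≤-<-trans (0≤eP {W zero} (W∈P zero))
          (subst (_< 0ℚ) (trans (dot-constant e≡ p p∈V) (sym (dot-constant e≡ (W zero) (Conv-InV inV (W∈P zero))))) (ap<0 A))))

-- Integers in ℚ

toℚᵘ-ι : ∀ z → toℚᵘ (ι z) ℚᵘ.≃ mkℚᵘ z 0
toℚᵘ-ι z = toℚᵘ-fromℚᵘ (mkℚᵘ z 0)

ι-+ : ∀ a b → ι (a ℤ.+ b) ≡ ι a + ι b
ι-+ a b = toℚᵘ-injective (begin
  toℚᵘ (ι (a ℤ.+ b))            ≈⟨ toℚᵘ-ι (a ℤ.+ b) ⟩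
  mkℚᵘ (a ℤ.+ b) 0              ≈⟨ *≡* (lem a b) ⟩
  mkℚᵘ a 0 ℚᵘ.+ mkℚᵘ b 0        ≈⟨ ℚᵘ.+-cong (toℚᵘ-ι a) (toℚᵘ-ι b) ⟨
  toℚᵘ (ι a) ℚᵘ.+ toℚᵘ (ι b)    ≈⟨ toℚᵘ-homo-+ (ι a) (ι b) ⟨
  toℚᵘ (ι a + ι b) ∎)
  where
  open ℚᵘ.≃-Reasoning
  lem : ∀ a b → (a ℤ.+ b) ℤ.* ℤ.+ 1 ≡ (a ℤ.* ℤ.+ 1 ℤ.+ b ℤ.* ℤ.+ 1) ℤ.* ℤ.+ 1
  lem = solve-∀

ι-neg : ∀ a → ι (ℤ.- a) ≡ - ι a
ι-neg a = ≡-by (trans (sym (ι-+ (ℤ.- a) a)) (cong ι (ℤ.+-inverseˡ a)))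
  (ι (ℤ.- a) + ι a ≡ ι (ℤ.- a) - - ι a ∋ solve 2 (λ a b → a :+ b := a :- (:- b)) refl (ι (ℤ.- a)) (ι a))

ι-suc : ∀ a → ι (a ℤ.+ ℤ.+ 1) ≡ ι a + 1ℚ
ι-suc a = ι-+ a (ℤ.+ 1)

ι-mono-≤ : ∀ {a b} → a ℤ.≤ b → ι a ≤ ι b
ι-mono-≤ {a} {b} a≤b = toℚᵘ-cancel-≤ (ℚᵘ.≤-respˡ-≃ (ℚᵘ.≃-sym (toℚᵘ-ι a)) (ℚᵘ.≤-respʳ-≃ (ℚᵘ.≃-sym (toℚᵘ-ι b))
  (ℚᵘ.*≤* (ℤ.*-monoʳ-≤-nonNeg (ℤ.+ 1) a≤b))))

ι-cancel-< : ∀ a b → ι a < ι b → a ℤ.< b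
ι-cancel-< a b ιa<ιb with a ℤ.<? b
... | yes a<b = a<b
... | no  a≮b = ⊥-elim (<-irrefl refl (<-≤-trans ιa<ιb (ι-mono-≤ (ℤ.≮⇒≥ a≮b))))

suc≤ : ∀ {a b} → a ℤ.< b → a ℤ.+ ℤ.+ 1 ℤ.≤ b
suc≤ {a} {b} a<b = subst (ℤ._≤ b) (ℤ.+-comm (ℤ.+ 1) a) (ℤ.i<j⇒suc[i]≤j a<b)

ι-discrete : ∀ a b → ι a < ι b → ι a + 1ℚ ≤ ι b
ι-discrete a b ιa<ιb = subst (_≤ ι b) (ι-suc a) (ι-mono-≤ (suc≤ (ι-cancel-< a b ιa<ιb)))

no-integer-between : ∀ a b → ι a < ι b → ι b < ι a + 1ℚ → ⊥
no-integer-between a b p q = <-irrefl refl (<-≤-trans q (ι-discrete a b p))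

floor-spec : ∀ q → ∃[ z ] (ι z ≤ q × q < ι z + 1ℚ)
floor-spec q@(mkℚ n d _) = z , toℚᵘ-cancel-≤ (ℚᵘ.≤-respˡ-≃ (ℚᵘ.≃-sym (toℚᵘ-ι z)) (ℚᵘ.*≤* lower)) ,
  subst (q <_) (ι-suc z) (toℚᵘ-cancel-< (ℚᵘ.<-respʳ-≃ (ℚᵘ.≃-sym (toℚᵘ-ι (z ℤ.+ ℤ.+ 1))) (ℚᵘ.*<* upper)))
  where
  D = ℤ.+ suc d
  z = n ℤ./ℕ suc d
  r = n ℤ.%ℕ suc d
  eq : n ≡ ℤ.+ r ℤ.+ z ℤ.* D
  eq = ℤ.a≡a%ℕn+[a/ℕn]*n n (suc d)
  lower : z ℤ.* D ℤ.≤ n ℤ.* ℤ.+ 1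
  lower = subst (z ℤ.* D ℤ.≤_) (trans (sym eq) (sym (ℤ.*-identityʳ n))) (ℤ.i≤j+i (z ℤ.* D) (ℤ.+ r))
  upper : n ℤ.* ℤ.+ 1 ℤ.< (z ℤ.+ ℤ.+ 1) ℤ.* D
  upper = subst₂ ℤ._<_ (trans (sym eq) (sym (ℤ.*-identityʳ n))) (lem z D)
    (ℤ.+-monoˡ-< (z ℤ.* D) (ℤ.+<+ (ℤ.n%ℕd<d n (suc d))))
    where
    lem : ∀ z D → D ℤ.+ z ℤ.* D ≡ (z ℤ.+ ℤ.+ 1) ℤ.* D
    lem = solve-∀

-- Positive scalars near 0

Eventually : (ℚ → Set) → Set
Eventually Q = ∃[ ε ] (0ℚ < ε × (∀ t → 0ℚ ≤ t → t ≤ ε → Q t))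

eventually-∀ : ∀ {m} {Q : Fin m → ℚ → Set} → (∀ l → Eventually (Q l)) → Eventually (λ t → ∀ l → Q l t)
eventually-∀ {zero}  ev = 1ℚ , 0<1 , λ _ _ _ ()
eventually-∀ {suc m} {Q} ev = combine (ev zero) (eventually-∀ (ev ∘ suc))
  where
  combine : Eventually (Q zero) → Eventually (λ t → ∀ l → Q (suc l) t) → Eventually (λ t → ∀ l → Q l t)
  combine (ε , 0<ε , q) (δ , 0<δ , r) = case ≤-total ε δ of λ where
    (inj₁ ε≤δ) → ε , 0<ε , λ t 0≤t t≤ε → λ { zero → q t 0≤t t≤ε ; (suc l) → r t 0≤t (≤-trans t≤ε ε≤δ) l }
    (inj₂ δ≤ε) → δ , 0<δ , λ t 0≤t t≤δ → λ { zero → q t 0≤t (≤-trans t≤δ δ≤ε) ; (suc l) → r t 0≤t t≤δ l }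

-- One `ε` serves all integers `z`: with `f` the floor of `- r`, those below `r` are at most
-- `- (f + 1)`, which is `δ` below `r`. If `g ≤ r`, a parameter up to `δ / (δ + (r - g))` lowers the
-- value by less than `δ`.
eventually-above : ∀ r g → Eventually (λ t → ∀ z → ι z < r → ι z < r + t * (g - r))
eventually-above r g = from-ceiling (floor-spec (- r))
  where
  Q = λ t → ∀ z → ι z < r → ι z < r + t * (g - r)
  from-ceiling : ∃[ f ] (ι f ≤ - r × - r < ι f + 1ℚ) → Eventually Q
  from-ceiling (f , f≤-r , -r<f+1) = case ≤-total r g of λ where
      (inj₁ r≤g) → 1ℚ , 0<1 , λ t 0≤t _ z z<r →
        <-by (0<+ (0<- z<r) (0≤* 0≤t (0≤- r≤g))) (r - ι z + t * (g - r) ≡ r + t * (g - r) - ι z ∋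
              solve 4 (λ a b c d → a :- b :+ c :* (d :- a) := a :+ c :* (d :- a) :- b) refl r (ι z) t g)
      (inj₂ g≤r) → falling g≤r (recip-pos (δ + (r - g)) (0<+ 0<δ (0≤- g≤r)))
    where
    δ = r + (ι f + 1ℚ)
    0<δ : 0ℚ < δ
    0<δ = <-by (0<- -r<f+1) (ι f + 1ℚ - - r ≡ r + (ι f + 1ℚ) - 0ℚ ∋
          solve 2 (λ a b → a :+ con 1ℚ :- (:- b) := b :+ (a :+ con 1ℚ) :- con 0ℚ) refl (ι f) r)
    below : ∀ z → ι z < r → ι z ≤ - (ι f + 1ℚ)
    below z z<r = ≤-by (0≤- (ι-discrete z (ℤ.- f) (<-≤-trans z<r r≤-f)))
      (trans (cong (_- (ι z + 1ℚ)) (ι-neg f)) (- ι f - (ι z + 1ℚ) ≡ - (ι f + 1ℚ) - ι z ∋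
            solve 2 (λ a b → (:- a) :- (b :+ con 1ℚ) := (:- (a :+ con 1ℚ)) :- b) refl (ι f) (ι z)))
      where
      r≤-f : r ≤ ι (ℤ.- f)
      r≤-f = ≤-by (0≤- f≤-r) (trans (- r - ι f ≡ - ι f - r ∋
            solve 2 (λ a b → (:- a) :- b := (:- b) :- a) refl r (ι f)) (cong (_- r) (sym (ι-neg f))))
    falling : g ≤ r → ∃[ s ] (0ℚ < s × (δ + (r - g)) * s ≡ 1ℚ) → Eventually Q
    falling g≤r (s , 0<s , eq) = δ * s , 0<* 0<δ 0<s , λ t 0≤t t≤δs z z<r →
      <-by (0<+ (0<+ (0<* 0<δ (0<* 0<δ 0<s)) (0≤* (0≤- t≤δs) (0≤- g≤r))) (0≤- (below z z<r))) (begin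
        δ * (δ * s) + (δ * s - t) * (r - g) + (- (ι f + 1ℚ) - ι z)
          ≡⟨ solve 7 (λ a b c d e f g → a :* (a :* b) :+ (a :* b :- c) :* (d :- e) :+ ((:- (f :+ con 1ℚ)) :- g) := a :* ((a :+ (d :- e)) :* b) :- c :* (d :- e) :+ ((:- (f :+ con 1ℚ)) :- g))
                refl δ s t r g (ι f) (ι z) ⟩
        δ * ((δ + (r - g)) * s) - t * (r - g) + (- (ι f + 1ℚ) - ι z)
          ≡⟨ cong (λ u → δ * u - t * (r - g) + (- (ι f + 1ℚ) - ι z)) eq ⟩
        (r + (ι f + 1ℚ)) * 1ℚ - t * (r - g) + (- (ι f + 1ℚ) - ι z)
          ≡⟨ solve 5 (λ a b c d e → (a :+ (b :+ con 1ℚ)) :* con 1ℚ :- c :* (a :- d) :+ ((:- (b :+ con 1ℚ)) :- e) := a :+ c :* (d :- a) :- e)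
                refl r (ι f) t g (ι z) ⟩
        r + t * (g - r) - ι z ∎)
      where open ≡-Reasoning

-- Averages

root-lincomb : ∀ {m n} (i j : Fin n) (c : Fin m → ℚ) (W : Fin m → Pt n) →
               root i j (lincomb c W) ≡ sumℚ (λ l → c l * root i j (W l))
root-lincomb i j c W = sym (trans (sum-cong λ l → c l * (W l i - W l j) ≡ c l * W l i - c l * W l j ∋
      solve 3 (λ a b c → a :* (b :- c) := a :* b :- a :* c) refl (c l) (W l i) (W l j))
  (sum-minus (λ l → c l * W l i) (λ l → c l * W l j)))

Conv-Conv : ∀ {m k n} {vs : Fin m → Pt n} {W : Fin k → Pt n} {x : Pt n} →
            (∀ l → Conv vs (W l)) → Conv W x → Conv vs x
Conv-Conv {vs = vs} {W} {x} W∈ (c , 0≤c , sum≡1 , x≐) =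
  (λ v → sumℚ (λ l → c l * proj₁ (W∈ l) v)) ,
  (λ v → sum-nonneg (λ l → 0≤* (0≤c l) (proj₁ (proj₂ (W∈ l)) v))) ,
  (begin
    sumℚ (λ v → sumℚ (λ l → c l * proj₁ (W∈ l) v))   ≡⟨ sum-swap (λ v l → c l * proj₁ (W∈ l) v) ⟩
    sumℚ (λ l → sumℚ (λ v → c l * proj₁ (W∈ l) v))   ≡⟨ sum-cong (λ l → trans (sum-* (c l) (proj₁ (W∈ l)))
                                                          (trans (cong (c l *_) (proj₁ (proj₂ (proj₂ (W∈ l))))) (*-identityʳ (c l)))) ⟩
    sumℚ c                                           ≡⟨ sum≡1 ⟩
    1ℚ ∎) ,
  λ i → begin
    x i                                                      ≡⟨ x≐ i ⟩
    sumℚ (λ l → c l * W l i)                                 ≡⟨ sum-cong (λ l → trans (cong (c l *_) (proj₂ (proj₂ (proj₂ (W∈ l))) i))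
                                                                  (sym (sum-* (c l) (λ v → proj₁ (W∈ l) v * vs v i)))) ⟩
    sumℚ (λ l → sumℚ (λ v → c l * (proj₁ (W∈ l) v * vs v i)))  ≡⟨ sum-swap (λ l v → c l * (proj₁ (W∈ l) v * vs v i)) ⟩
    sumℚ (λ v → sumℚ (λ l → c l * (proj₁ (W∈ l) v * vs v i)))  ≡⟨ sum-cong (λ v → trans
        (sum-cong λ l → c l * (proj₁ (W∈ l) v * vs v i) ≡ vs v i * (c l * proj₁ (W∈ l) v) ∋
              solve 3 (λ a b c → a :* (b :* c) := c :* (a :* b)) refl (c l) (proj₁ (W∈ l) v) (vs v i))
        (trans (sum-* (vs v i) (λ l → c l * proj₁ (W∈ l) v)) (*-comm (vs v i) (sumℚ (λ l → c l * proj₁ (W∈ l) v))))) ⟩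
    lincomb (λ v → sumℚ (λ l → c l * proj₁ (W∈ l) v)) vs i ∎
  where open ≡-Reasoning

Conv-segment : ∀ {m n} {vs : Fin m → Pt n} {x y : Pt n} → Conv vs x → Conv vs y → ∀ t → 0ℚ ≤ t → t ≤ 1ℚ →
               Conv vs (axpy x t (λ i → y i - x i))
Conv-segment {x = x} {y} x∈ y∈ t 0≤t t≤1 = Conv-Conv {k = 2} {W = x ∷ y ∷ (λ ())}
  (λ { zero → x∈ ; (suc zero) → y∈ })
  ((1ℚ - t ∷ t ∷ λ ()) , (λ { zero → 0≤- t≤1 ; (suc zero) → 0≤t }) ,
   (1ℚ - t + (t + 0ℚ) ≡ 1ℚ ∋ solve 1 (λ a → con 1ℚ :- a :+ (a :+ con 0ℚ) := con 1ℚ) refl t) ,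
   λ i → x i + t * (y i - x i) ≡ (1ℚ - t) * x i + (t * y i + 0ℚ) ∋
         solve 3 (λ a b c → a :+ b :* (c :- a) := (con 1ℚ :- b) :* a :+ (b :* c :+ con 0ℚ)) refl (x i) t (y i))

1/N : ∀ r → ∃[ s ] (0ℚ < s × sumℚ (𝟙 {suc r}) * s ≡ 1ℚ)
1/N r = recip-pos (sumℚ (𝟙 {suc r})) (0<sum-𝟙 r)

barycentre : ∀ {r n} → (Fin (suc r) → Pt n) → Pt n
barycentre {r} = lincomb (λ _ → proj₁ (1/N r))

mean : ∀ {r} → (Fin (suc r) → ℚ) → ℚ
mean {r} f = proj₁ (1/N r) * sumℚ f

root-barycentre : ∀ {r n} (i j : Fin n) (S : Fin (suc r) → Pt n) →
                  root i j (barycentre S) ≡ mean (λ l → root i j (S l))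
root-barycentre {r} i j S = trans (root-lincomb i j (λ _ → proj₁ (1/N r)) S) (sum-* (proj₁ (1/N r)) (λ l → root i j (S l)))

Conv-barycentre : ∀ {r n} (S : Fin (suc r) → Pt n) → Conv S (barycentre S)
Conv-barycentre {r} S = (λ _ → s) , (λ _ → <⇒≤ 0<s) ,
  (begin
    sumℚ (λ (_ : Fin (suc r)) → s)       ≡⟨ sum-cong {suc r} (λ _ → sym (*-identityʳ s)) ⟩
    sumℚ (λ (_ : Fin (suc r)) → s * 1ℚ)  ≡⟨ sum-* {suc r} s 𝟙 ⟩
    s * sumℚ (𝟙 {suc r})                 ≡⟨ *-comm s (sumℚ (𝟙 {suc r})) ⟩
    sumℚ (𝟙 {suc r}) * s                 ≡⟨ Ns≡1 ⟩
    1ℚ ∎) , λ _ → refl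
  where
  open ≡-Reasoning
  s = proj₁ (1/N r)
  0<s = proj₁ (proj₂ (1/N r))
  Ns≡1 = proj₂ (proj₂ (1/N r))

mean-shift : ∀ {r} (a : ℚ) (f : Fin (suc r) → ℚ) → mean (λ l → f l - a) ≡ mean f - a
mean-shift {r} a f = begin
  s * sumℚ (λ l → f l - a)              ≡⟨ cong (s *_) (sum-minus f (λ _ → a)) ⟩
  s * (sumℚ f - sumℚ (λ (_ : Fin (suc r)) → a))  ≡⟨ cong (λ u → s * (sumℚ f - u)) (trans (sum-cong {suc r} (λ _ → sym (*-identityʳ a))) (sum-* a (𝟙 {suc r}))) ⟩
  s * (sumℚ f - a * N)
    ≡⟨ solve 4 (λ a b c d → a :* (b :- c :* d) := a :* b :- c :* (d :* a)) refl s (sumℚ f) a N ⟩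
  s * sumℚ f - a * (N * s)              ≡⟨ cong (λ u → s * sumℚ f - a * u) (proj₂ (proj₂ (1/N r))) ⟩
  s * sumℚ f - a * 1ℚ                   ≡⟨ cong (λ u → s * sumℚ f - u) (*-identityʳ a) ⟩
  mean f - a ∎
  where
  open ≡-Reasoning
  s = proj₁ (1/N r)
  N = sumℚ (𝟙 {suc r})

mean-neg : ∀ {r} (f : Fin (suc r) → ℚ) → mean (λ l → - f l) ≡ - mean f
mean-neg {r} f = begin
  s * sumℚ (λ l → - f l)      ≡⟨ cong (s *_) (trans (sum-cong λ l → - f l ≡ - 1ℚ * f l ∋
        solve 1 (λ a → :- a := (:- con 1ℚ) :* a) refl (f l)) (sum-* (- 1ℚ) f)) ⟩
  s * (- 1ℚ * sumℚ f)         ≡⟨ solve 2 (λ a b → a :* ((:- con 1ℚ) :* b) := :- (a :* b)) refl s (sumℚ f) ⟩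
  - (s * sumℚ f) ∎
  where
  open ≡-Reasoning
  s = proj₁ (1/N r)

<-mean : ∀ {r} (a : ℚ) (f : Fin (suc r) → ℚ) → (∀ l → a ≤ f l) → ∃[ l ] a < f l → a < mean f
<-mean {r} a f a≤f (l , a<fl) = <-by (0<* (proj₁ (proj₂ (1/N r))) (sum-pos (λ l → 0≤- (a≤f l)) (l , 0<- a<fl))) (mean-shift a f)

mean-< : ∀ {r} (b : ℚ) (f : Fin (suc r) → ℚ) → (∀ l → f l ≤ b) → ∃[ l ] f l < b → mean f < b
mean-< b f f≤b (l , fl<b) = neg-cancel-< (subst (- b <_) (mean-neg f)
  (<-mean (- b) (λ l → - f l) (λ l → neg-antimono-≤ (f≤b l)) (l , neg-antimono-< fl<b)))
  where
  neg-cancel-< : ∀ {x y} → - y < - x → x < y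
  neg-cancel-< {x} {y} p = <-by (0<- p) (- x - - y ≡ y - x ∋
        solve 2 (λ a b → (:- a) :- (:- b) := b :- a) refl x y)

≤∧≢⇒< : ∀ {a b} → a ≤ b → a ≢ b → a < b
≤∧≢⇒< {a} {b} a≤b a≢b = <-by (0≤∧≢0⇒0< (0≤- a≤b) (λ q → a≢b (sym (≡-by q refl)))) refl

-- Regions of the arrangement of lattice hyperplanes

InSlabs : ∀ {n} → (Fin n → Fin n → ℤ) → Pt n → Set
InSlabs {n} k x = ∀ (i j : Fin n) → i ≢ j → (ι (k i j) ≤ root i j x) × (root i j x ≤ ι (k i j ℤ.+ ℤ.+ 1))

InOpenSlabs : ∀ {n} → (Fin n → Fin n → ℤ) → Pt n → Set
InOpenSlabs {n} k x = ∀ (i j : Fin n) → i ≢ j → (ι (k i j) < root i j x) × (root i j x < ι (k i j) + 1ℚ)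

-- The standard basis; `e l p` also serves as the Kronecker delta.
e : ∀ {n} → Fin n → Pt n
e zero    = 1ℚ ∷ (λ _ → 0ℚ)
e (suc i) = 0ℚ ∷ e i

e-≡ : ∀ {n} (i : Fin n) → e i i ≡ 1ℚ
e-≡ zero    = refl
e-≡ (suc i) = e-≡ i

e-≢ : ∀ {n} (i j : Fin n) → i ≢ j → e i j ≡ 0ℚ
e-≢ zero    zero    i≢j = contradiction refl i≢j
e-≢ zero    (suc j) i≢j = refl
e-≢ (suc i) zero    i≢j = refl
e-≢ (suc i) (suc j) i≢j = e-≢ i j (i≢j ∘ cong suc)

dot-e : ∀ {n} (i : Fin n) (x : Pt n) → ⟨ e i , x ⟩ ≡ x i
dot-e zero x = begin
  1ℚ * x zero + sumℚ (λ i → 0ℚ * x (suc i))  ≡⟨ cong (1ℚ * x zero +_) (sum-0 (λ i → *-zeroˡ (x (suc i)))) ⟩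
  1ℚ * x zero + 0ℚ                           ≡⟨ solve 1 (λ a → con 1ℚ :* a :+ con 0ℚ := a) refl (x zero) ⟩
  x zero ∎
  where open ≡-Reasoning
dot-e (suc i) x = begin
  0ℚ * x zero + ⟨ e i , x ∘ suc ⟩  ≡⟨ cong (0ℚ * x zero +_) (dot-e i (x ∘ suc)) ⟩
  0ℚ * x zero + x (suc i)          ≡⟨ solve 2 (λ a b → con 0ℚ :* a :+ b := b) refl (x zero) (x (suc i)) ⟩
  x (suc i) ∎
  where open ≡-Reasoning

dot-𝟙 : ∀ {n} (x : Pt n) → ⟨ 𝟙 , x ⟩ ≡ sumℚ x
dot-𝟙 x = sum-cong (λ i → *-identityˡ (x i))

-- If the root had constant value `c`, the functional `e i - e j - (c / N) 𝟙` would vanish on the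
-- basis `hat ∘ W` and hence be zero, although its coordinates at `i` and `j` differ by `2`.
root-nonconstant : ∀ {d} (W : Fin (suc d) → Pt (suc d)) → (∀ l → InV (W l)) → AffInd W →
  ∀ {i j} → i ≢ j → ∀ c → ¬ (∀ l → root i j (W l) ≡ c)
root-nonconstant {d} W inV ind {i} {j} i≢j c const = 1+1≢0 (begin
  1ℚ + 1ℚ            ≡⟨ refl ⟩
  1ℚ - 0ℚ - (0ℚ - 1ℚ) ≡⟨ cong₂ _-_ (cong₂ _-_ (sym (e-≡ i)) (sym (e-≢ j i (i≢j ∘ sym)))) (cong₂ _-_ (sym (e-≢ i j i≢j)) (sym (e-≡ j))) ⟩
  e i i - e j i - (e i j - e j j)
    ≡⟨ solve 6 (λ a b c d e f → a :- b :- (c :- d) := a :+ (:- con 1ℚ) :* b :+ (:- (e :* f)) :* con 1ℚ :- (c :+ (:- con 1ℚ) :* d :+ (:- (e :* f)) :* con 1ℚ))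
         refl (e i i) (e j i) (e i j) (e j j) s c ⟩
  (e i i + - 1ℚ * e j i + - (s * c) * 1ℚ) - (e i j + - 1ℚ * e j j + - (s * c) * 1ℚ) ≡⟨ cong₂ _-_ (f≡0 i) (f≡0 j) ⟩
  0ℚ - 0ℚ            ≡⟨⟩
  0ℚ ∎)
  where
  open ≡-Reasoning
  1+1≢0 : 1ℚ + 1ℚ ≢ 0ℚ
  1+1≢0 ()
  N = sumℚ (𝟙 {suc d})
  s = proj₁ (1/N d)
  f : Pt (suc d)
  f = axpy (axpy (e i) (- 1ℚ) (e j)) (- (s * c)) 𝟙
  f≡0 : ∀ i → f i ≡ 0ℚ
  f≡0 = orthogonal-to-basis {W = hat ∘ W} (AffInd⇒LinInd W inV ind) f λ l → begin
    ⟨ f , hat (W l) ⟩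
      ≡⟨ dot-axpyˡ (axpy (e i) (- 1ℚ) (e j)) (- (s * c)) 𝟙 (hat (W l)) ⟩
    ⟨ axpy (e i) (- 1ℚ) (e j) , hat (W l) ⟩ + - (s * c) * ⟨ 𝟙 , hat (W l) ⟩
      ≡⟨ cong₂ (λ u v → u + - (s * c) * v)
           (trans (dot-axpyˡ (e i) (- 1ℚ) (e j) (hat (W l)))
                  (cong₂ (λ u v → u + - 1ℚ * v) (dot-e i (hat (W l))) (dot-e j (hat (W l)))))
           (trans (dot-𝟙 (hat (W l))) (sum-hat (W l) (inV l))) ⟩
    (W l i + 1ℚ + - 1ℚ * (W l j + 1ℚ)) + - (s * c) * N
      ≡⟨ solve 5 (λ a b c d e → a :+ con 1ℚ :+ (:- con 1ℚ) :* (b :+ con 1ℚ) :+ (:- (c :* d)) :* e := a :- b :- d :* (e :* c))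
            refl (W l i) (W l j) s c N ⟩
    root i j (W l) - c * (N * s)
      ≡⟨ cong₂ (λ u v → u - c * v) (const l) (proj₂ (proj₂ (1/N d))) ⟩
    c - c * 1ℚ
      ≡⟨ solve 1 (λ a → a :- a :* con 1ℚ := con 0ℚ) refl c ⟩
    0ℚ ∎

-- The face order of the arrangement: `x` lies in the closure of the open face that contains `y`.
-- Strict upper bounds are covered by exchanging `i` and `j`.
_⊑_ : ∀ {n} → Pt n → Pt n → Set
_⊑_ {n} x y = ∀ (i j : Fin n) z → ι z < root i j x → ι z < root i j y

⊑-below : ∀ {n} {x y : Pt n} → x ⊑ y → ∀ i j z → root i j x < ι z → root i j y < ι z
⊑-below {x = x} {y} x⊑y i j z x<z = <-by (0<- (x⊑y j i (ℤ.- z) -z<x)) (begin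
  root j i y - ι (ℤ.- z)  ≡⟨ cong (λ u → root j i y - u) (ι-neg z) ⟩
  root j i y - - ι z      ≡⟨ solve 3 (λ a b c → a :- b :- (:- c) := c :- (b :- a)) refl (y j) (y i) (ι z) ⟩
  ι z - root i j y ∎)
  where
  open ≡-Reasoning
  -z<x : ι (ℤ.- z) < root j i x
  -z<x = <-by (0<- x<z) (trans (ι z - root i j x ≡ root j i x - - ι z ∋
        solve 3 (λ a b c → a :- (b :- c) := c :- b :- (:- a))
          refl (ι z) (x i) (x j)) (cong (λ u → root j i x - u) (sym (ι-neg z))))

⊑-integer : ∀ {n} {x y : Pt n} → x ⊑ y → ∀ i j z → root i j y ≡ ι z → root i j x ≡ ι z
⊑-integer {x = x} {y} x⊑y i j z y≡z = case <-cmp (root i j x) (ι z) of λ where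
  (tri< x<z _ _) → ⊥-elim (<-irrefl y≡z (⊑-below {x = x} {y} x⊑y i j z x<z))
  (tri≈ _ x≡z _) → x≡z
  (tri> _ _ z<x) → ⊥-elim (<-irrefl (sym y≡z) (x⊑y i j z z<x))

-- A sufficiently small move from `x` towards `g` preserves all strict lattice inequalities. If it
-- ends on a lattice hyperplane, then `x` was on it already, and the whole segment, including `g`,
-- lies on it.
perturb-towards : ∀ {m n} {vs : Fin m → Pt n} (x g : Pt n) → Conv vs x → Conv vs g →
  Σ (Pt n) λ y → Conv vs y × x ⊑ y ×
    (∀ i j z → root i j y ≡ ι z → root i j x ≡ ι z × root i j g ≡ ι z)
perturb-towards {vs = vs} x g x∈P g∈P =
  step (eventually-∀ λ i → eventually-∀ λ j → eventually-above (root i j x) (root i j g))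
  where
  Result = Σ (Pt _) λ y → Conv vs y × x ⊑ y ×
    (∀ i j z → root i j y ≡ ι z → root i j x ≡ ι z × root i j g ≡ ι z)
  Near : ℚ → Set
  Near t = ∀ i j z → ι z < root i j x → ι z < root i j x + t * (root i j g - root i j x)
  at : ∀ t → 0ℚ < t → t ≤ 1ℚ → Near t → Result
  at t 0<t t≤1 near = y , Conv-segment x∈P g∈P t (<⇒≤ 0<t) t≤1 , x⊑y , λ i j z y≡z →
    let x≡z = ⊑-integer {x = x} {y} x⊑y i j z y≡z
        tD≡0 = begin
          t * (root i j g - root i j x)
            ≡⟨ solve 5 (λ a b c d e → a :* (b :- c :- (d :- e)) := d :- e :+ a :* (b :- c :- (d :- e)) :- (d :- e))
                 refl t (g i) (g j) (x i) (x j) ⟩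
          root i j x + t * (root i j g - root i j x) - root i j x    ≡⟨ cong (_- root i j x) (root-y i j) ⟨
          root i j y - root i j x                                    ≡⟨ 0≡- (trans y≡z (sym x≡z)) ⟩
          0ℚ ∎
    in x≡z , trans (≡-by (*≡0 {t} tD≡0 (<-absurd 0<t)) refl) x≡z
    where
    open ≡-Reasoning
    y : Pt _
    y = axpy x t (λ i → g i - x i)
    root-y : ∀ i j → root i j y ≡ root i j x + t * (root i j g - root i j x)
    root-y i j = (x i + t * (g i - x i)) - (x j + t * (g j - x j)) ≡ root i j x + t * (root i j g - root i j x) ∋
          solve 5 (λ a b c d e → a :+ b :* (c :- a) :- (d :+ b :* (e :- d)) := a :- d :+ b :* (c :- e :- (a :- d)))
            refl (x i) t (g i) (x j) (g j)
    x⊑y : x ⊑ y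
    x⊑y i j z z<x = subst (ι z <_) (sym (root-y i j)) (near i j z z<x)
  step : Eventually Near → Result
  step (ε , 0<ε , near) = case ≤-total ε 1ℚ of λ where
    (inj₁ ε≤1) → at ε 0<ε ε≤1 (near ε (<⇒≤ 0<ε) ≤-refl)
    (inj₂ 1≤ε) → at 1ℚ 0<1 ≤-refl (near 1ℚ 0≤1 1≤ε)

-- Successive moves towards every `W l`: a lattice hyperplane through the final point has to contain
-- all of these points.
perturb : ∀ {m n} {vs : Fin m → Pt n} k (W : Fin k → Pt n) → (∀ l → Conv vs (W l)) → ∀ x → Conv vs x →
  Σ (Pt n) λ y → Conv vs y × x ⊑ y × (∀ i j z → root i j y ≡ ι z → ∀ l → root i j (W l) ≡ ι z)
perturb zero    W W∈P x x∈P = x , x∈P , (λ _ _ _ p → p) , λ _ _ _ _ ()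
perturb {vs = vs} (suc k) W W∈P x x∈P =
  let y  , y∈P  , x⊑y  , int  = perturb k (W ∘ suc) (W∈P ∘ suc) x x∈P
      y′ , y′∈P , y⊑y′ , int′ = perturb-towards {vs = vs} y (W zero) y∈P (W∈P zero)
  in y′ , y′∈P , (λ i j z p → y⊑y′ i j z (x⊑y i j z p)) ,
     λ i j z eq → λ { zero → proj₂ (int′ i j z eq) ; (suc l) → int i j z (proj₁ (int′ i j z eq)) l }

-- Perturbing `x` towards affinely independent points of `P` leaves every lattice hyperplane, as
-- none of them contains all these points. The floors of the roots of `y` name its region, and
-- `x ⊑ y` places `x` in the closure.
generic-point : ∀ {m d} (vs : Fin m → Pt (suc d)) → (∀ l → InV (vs l)) → FullDimInV (Polytope vs) →
  ∀ x → Conv vs x → Σ (Pt (suc d)) λ y → Conv vs y × ∃[ k ] (InOpenSlabs k y × InSlabs k x)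
generic-point {d = d} vs inV (W , W∈P , ind) x x∈P = from (perturb (suc d) W W∈P x x∈P)
  where
  from : (Σ (Pt (suc d)) λ y → Conv vs y × x ⊑ y × (∀ i j z → root i j y ≡ ι z → ∀ l → root i j (W l) ≡ ι z)) →
         Σ (Pt (suc d)) λ y → Conv vs y × ∃[ k ] (InOpenSlabs k y × InSlabs k x)
  from (y , y∈P , x⊑y , int) = y , y∈P , k , open-slabs , slabs
    where
    k : Fin (suc d) → Fin (suc d) → ℤ
    k i j = proj₁ (floor-spec (root i j y))
    k≤y : ∀ i j → ι (k i j) ≤ root i j y
    k≤y i j = proj₁ (proj₂ (floor-spec (root i j y)))
    y<k+1 : ∀ i j → root i j y < ι (k i j) + 1ℚ
    y<k+1 i j = proj₂ (proj₂ (floor-spec (root i j y)))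
    k≢y : ∀ i j → i ≢ j → ι (k i j) ≢ root i j y
    k≢y i j i≢j eq = root-nonconstant W (λ l → Conv-InV {vs = vs} inV (W∈P l)) ind i≢j (ι (k i j)) (int i j (k i j) (sym eq))
    open-slabs : InOpenSlabs k y
    open-slabs i j i≢j = ≤∧≢⇒< (k≤y i j) (k≢y i j i≢j) , y<k+1 i j
    slabs : InSlabs k x
    slabs i j i≢j =
      ≮⇒≥ (λ x<k → <-asym (⊑-below {x = x} {y} x⊑y i j (k i j) x<k) (proj₁ (open-slabs i j i≢j))) ,
      ≮⇒≥ (λ k+1<x → <-asym (subst (_< root i j y) (ι-suc (k i j)) (x⊑y i j (k i j ℤ.+ ℤ.+ 1) k+1<x)) (y<k+1 i j))

-- A facet separating p from y would lie on a lattice hyperplane that cuts the segment from y to p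
-- before p, hence inside the open region.
region⊆P : ∀ {m d} (vs : Fin m → Pt (suc d)) → IsTypeA vs → ∀ {k y p} → Conv vs y → InOpenSlabs k y →
  InV p → InSlabs k p → Conv vs p
region⊆P {d = d} vs (v∈Λ , full , facets) {k} {y} {p} y∈P y-open p∈V p-slabs =
  case facet-separation vs inV full p p∈V of λ where
    (inj₁ p∈P) → p∈P
    (inj₂ (a , b , facet@(_ , a≤b , _) , b<ap)) →
      ⊥-elim (cut a b (a≤b y y∈P) b<ap (recip-pos (⟨ a , p ⟩ - ⟨ a , y ⟩) (0<- (≤-<-trans (a≤b y y∈P) b<ap))) (facets a b facet))
  where
  open ≡-Reasoning
  inV : ∀ l → InV (vs l)
  inV l = proj₁ (v∈Λ l)
  cut : ∀ a b → ⟨ a , y ⟩ ≤ b → b < ⟨ a , p ⟩ → ∃[ s ] (0ℚ < s × (⟨ a , p ⟩ - ⟨ a , y ⟩) * s ≡ 1ℚ) →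
    (Σ (Fin (suc d)) λ i → Σ (Fin (suc d)) λ j → Σ ℤ λ w → i ≢ j × (∀ x → InV x → (⟨ a , x ⟩ ≡ b) ⇔ (root i j x ≡ ι w))) → ⊥
  cut a b ay≤b b<ap (s , 0<s , eq) (i , j , w , i≢j , hyp) =
    no-integer-between (k i j) w
      (<-by (0<+ (0<* 0<1-t (0<- k<y)) (0≤* 0≤t (0≤- k≤p)))
        (trans ((1ℚ - t) * (root i j y - ι (k i j)) + t * (root i j p - ι (k i j)) ≡ root i j y + t * (root i j p - root i j y) - ι (k i j) ∋
              solve 6 (λ a b c d e f → (con 1ℚ :- a) :* (b :- c :- d) :+ a :* (e :- f :- d) := b :- c :+ a :* (e :- f :- (b :- c)) :- d)
                refl t (y i) (y j) (ι (k i j)) (p i) (p j))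
               (cong (_- ι (k i j)) w≡)))
      (<-by (0<+ (0<* 0<1-t (0<- y<k+1)) (0≤* 0≤t (0≤- p≤k+1)))
        (trans ((1ℚ - t) * (ι (k i j) + 1ℚ - root i j y) + t * (ι (k i j) + 1ℚ - root i j p) ≡ ι (k i j) + 1ℚ - (root i j y + t * (root i j p - root i j y)) ∋
              solve 6 (λ a b c d e f → (con 1ℚ :- a) :* (b :+ con 1ℚ :- (c :- d)) :+ a :* (b :+ con 1ℚ :- (e :- f)) := b :+ con 1ℚ :- (c :- d :+ a :* (e :- f :- (c :- d))))
                refl t (ι (k i j)) (y i) (y j) (p i) (p j))
               (cong (λ u → ι (k i j) + 1ℚ - u) w≡)))
    where
    k<y = proj₁ (y-open i j i≢j)
    y<k+1 = proj₂ (y-open i j i≢j)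
    k≤p = proj₁ (p-slabs i j i≢j)
    p≤k+1 : root i j p ≤ ι (k i j) + 1ℚ
    p≤k+1 = subst (root i j p ≤_) (ι-suc (k i j)) (proj₂ (p-slabs i j i≢j))
    -- The segment from `y` to `p` meets the facet hyperplane at parameter `t`. Since `p` is
    -- strictly beyond it, `1 - t` is positive, and this weight on `y` makes both slab inequalities
    -- strict at the crossing point.
    t = (b - ⟨ a , y ⟩) * s
    0≤t : 0ℚ ≤ t
    0≤t = 0≤* (0≤- ay≤b) (<⇒≤ 0<s)
    0<1-t : 0ℚ < 1ℚ - t
    0<1-t = <-by (0<* (0<- b<ap) 0<s) (begin
      (⟨ a , p ⟩ - b) * s
        ≡⟨ solve 4 (λ a b c d → (a :- b) :* c := (a :- d) :* c :- (b :- d) :* c :- con 0ℚ)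
             refl (⟨ a , p ⟩) b s (⟨ a , y ⟩) ⟩
      (⟨ a , p ⟩ - ⟨ a , y ⟩) * s - (b - ⟨ a , y ⟩) * s - 0ℚ  ≡⟨ cong (λ u → u - (b - ⟨ a , y ⟩) * s - 0ℚ) eq ⟩
      1ℚ - t - 0ℚ ∎)
    z : Pt (suc d)
    z = axpy y t (λ i → p i - y i)
    z∈V : InV z
    z∈V = begin
      sumℚ z                                 ≡⟨ sum-+* y t (λ i → p i - y i) ⟩
      sumℚ y + t * sumℚ (λ i → p i - y i)    ≡⟨ cong₂ (λ u v → u + t * v) y∈V (trans (sum-minus p y) (cong₂ _-_ p∈V y∈V)) ⟩
      0ℚ + t * (0ℚ - 0ℚ)
        ≡⟨ solve 1 (λ a → con 0ℚ :+ a :* (con 0ℚ :- con 0ℚ) := con 0ℚ) refl t ⟩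
      0ℚ ∎
      where
      y∈V : sumℚ y ≡ 0ℚ
      y∈V = Conv-InV {vs = vs} inV y∈P
    az≡b : ⟨ a , z ⟩ ≡ b
    az≡b = begin
      ⟨ a , z ⟩                                                ≡⟨ dot-axpyʳ a y t (λ i → p i - y i) ⟩
      ⟨ a , y ⟩ + t * ⟨ a , (λ i → p i - y i) ⟩                ≡⟨ cong (λ u → ⟨ a , y ⟩ + t * u) (trans
                                                                  (sum-cong λ i → a i * (p i - y i) ≡ a i * p i - a i * y i ∋
                                                                        solve 3 (λ a b c → a :* (b :- c) := a :* b :- a :* c)
                                                                          refl (a i) (p i) (y i))
                                                                  (sum-minus (λ i → a i * p i) (λ i → a i * y i))) ⟩
      ⟨ a , y ⟩ + (b - ⟨ a , y ⟩) * s * (⟨ a , p ⟩ - ⟨ a , y ⟩)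
        ≡⟨ solve 4 (λ a b c d → a :+ (b :- a) :* c :* (d :- a) := a :+ (b :- a) :* ((d :- a) :* c))
             refl (⟨ a , y ⟩) b s (⟨ a , p ⟩) ⟩
      ⟨ a , y ⟩ + (b - ⟨ a , y ⟩) * ((⟨ a , p ⟩ - ⟨ a , y ⟩) * s) ≡⟨ cong (λ u → ⟨ a , y ⟩ + (b - ⟨ a , y ⟩) * u) eq ⟩
      ⟨ a , y ⟩ + (b - ⟨ a , y ⟩) * 1ℚ
        ≡⟨ solve 2 (λ a b → a :+ (b :- a) :* con 1ℚ := b) refl (⟨ a , y ⟩) b ⟩
      b ∎
    w≡ : root i j y + t * (root i j p - root i j y) ≡ ι w
    w≡ = begin
      root i j y + t * (root i j p - root i j y)
        ≡⟨ solve 5 (λ a b c d e → a :- b :+ c :* (d :- e :- (a :- b)) := a :+ c :* (d :- a) :- (b :+ c :* (e :- b)))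
             refl (y i) (y j) t (p i) (p j) ⟩
      (y i + t * (p i - y i)) - (y j + t * (p j - y j))                ≡⟨ Equivalence.to (hyp z z∈V) az≡b ⟩
      ι w ∎

-- No root is constant on the affinely independent points, so for each wall one of them is off the
-- wall; averaging therefore makes every slab inequality strict at the barycentre.
full⇒interior : ∀ {m d} (vs : Fin m → Pt (suc d)) → (∀ l → InV (vs l)) → ∀ {k} → FullDimInV (DicingCell vs k) →
  Σ (Pt (suc d)) λ y → Conv vs y × InOpenSlabs k y
full⇒interior {d = d} vs inV {k} (W , W∈C , ind) =
  barycentre W , Conv-Conv (λ l → proj₁ (W∈C l)) (Conv-barycentre W) , λ i j i≢j →
    let k≤W   = λ l → proj₁ (proj₂ (W∈C l) i j i≢j)
        W≤k+1 = λ l → subst (root i j (W l) ≤_) (ι-suc (k i j)) (proj₂ (proj₂ (W∈C l) i j i≢j))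
        l₁ , W≢k   = differs i≢j (ι (k i j))
        l₂ , W≢k+1 = differs i≢j (ι (k i j) + 1ℚ)
        f = λ l → root i j (W l)
    in subst (ι (k i j) <_) (sym (root-barycentre i j W))
         (<-mean (ι (k i j)) f k≤W (l₁ , ≤∧≢⇒< (k≤W l₁) (W≢k ∘ sym))) ,
       subst (_< ι (k i j) + 1ℚ) (sym (root-barycentre i j W))
         (mean-< (ι (k i j) + 1ℚ) f W≤k+1 (l₂ , ≤∧≢⇒< (W≤k+1 l₂) W≢k+1))
  where
  differs : ∀ {i j} → i ≢ j → ∀ c → ∃[ l ] root i j (W l) ≢ c
  differs {i} {j} i≢j c = case Fin.any? (λ l → ¬? (root i j (W l) ≟ c)) of λ where
    (yes p) → p
    (no ¬p) → ⊥-elim (root-nonconstant W (λ l → Conv-InV {vs = vs} inV (proj₁ (W∈C l))) ind i≢j c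
      (λ l → decidable-stable (root i j (W l) ≟ c) (λ q → ¬p (l , q))))

-- Ranking

count : ∀ {n} {P : Fin n → Set} → (∀ i → Dec (P i)) → ℕ
count {zero}  P? = 0
count {suc n} P? with P? zero
... | yes _ = suc (count (P? ∘ suc))
... | no  _ = count (P? ∘ suc)

count-mono : ∀ {n} {P Q : Fin n → Set} (P? : ∀ i → Dec (P i)) (Q? : ∀ i → Dec (Q i)) →
             (∀ i → P i → Q i) → count P? ℕ.≤ count Q?
count-mono {zero}  P? Q? P⊆Q = ℕ.z≤n
count-mono {suc n} P? Q? P⊆Q with P? zero | Q? zero
... | yes _ | yes _ = ℕ.s≤s (count-mono (P? ∘ suc) (Q? ∘ suc) (P⊆Q ∘ suc))
... | yes p | no ¬q = contradiction (P⊆Q zero p) ¬q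
... | no  _ | yes _ = ℕ.m≤n⇒m≤1+n (count-mono (P? ∘ suc) (Q? ∘ suc) (P⊆Q ∘ suc))
... | no  _ | no  _ = count-mono (P? ∘ suc) (Q? ∘ suc) (P⊆Q ∘ suc)

count-mono-< : ∀ {n} {P Q : Fin n → Set} (P? : ∀ i → Dec (P i)) (Q? : ∀ i → Dec (Q i)) →
               (∀ i → P i → Q i) → ∀ i → ¬ P i → Q i → count P? ℕ.< count Q?
count-mono-< P? Q? P⊆Q zero ¬p q with P? zero | Q? zero
... | yes p | _      = contradiction p ¬p
... | no  _ | no ¬q  = contradiction q ¬q
... | no  _ | yes _  = ℕ.s≤s (count-mono (P? ∘ suc) (Q? ∘ suc) (P⊆Q ∘ suc))
count-mono-< P? Q? P⊆Q (suc i) ¬p q with P? zero | Q? zero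
... | yes _ | yes _ = ℕ.s≤s (count-mono-< (P? ∘ suc) (Q? ∘ suc) (P⊆Q ∘ suc) i ¬p q)
... | yes p | no ¬q = contradiction (P⊆Q zero p) ¬q
... | no  _ | yes _ = ℕ.m≤n⇒m≤1+n (count-mono-< (P? ∘ suc) (Q? ∘ suc) (P⊆Q ∘ suc) i ¬p q)
... | no  _ | no  _ = count-mono-< (P? ∘ suc) (Q? ∘ suc) (P⊆Q ∘ suc) i ¬p q

count≤n : ∀ {n} {P : Fin n → Set} (P? : ∀ i → Dec (P i)) → count P? ℕ.≤ n
count≤n {zero}  P? = ℕ.z≤n
count≤n {suc n} P? with P? zero
... | yes _ = ℕ.s≤s (count≤n (P? ∘ suc))
... | no  _ = ℕ.m≤n⇒m≤1+n (count≤n (P? ∘ suc))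

-- Pigeonhole: if `a` were missed, punching it out would give an injection into a smaller set.
injective⇒surjective : ∀ {n} (r : Fin n → Fin n) → (∀ {i j} → r i ≡ r j → i ≡ j) → ∀ a → ∃[ i ] r i ≡ a
injective⇒surjective {suc n} r inj a = case Fin.any? (λ i → r i Fin.≟ a) of λ where
  (yes p) → p
  (no ¬p) → ⊥-elim (Fin.<⇒notInjective
    {f = λ i → punchOut {i = a} (λ a≡ → ¬p (i , sym a≡))} (ℕ.n<1+n n) (λ eq → inj (Fin.punchOut-injective {i = a} _ _ eq)))

record Ranking {n} (f : Fin n → ℚ) : Set where
  field
    r    : Fin n → Fin n
    σ    : Fin n → Fin n
    r∘σ  : ∀ a → r (σ a) ≡ a
    σ∘r  : ∀ i → σ (r i) ≡ i
    anti : ∀ i j → f j < f i → toℕ (r i) ℕ.< toℕ (r j)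

-- The rank of `i` is the number of indices with a strictly larger value. Distinct values have
-- distinct ranks, so `r` is injective and hence bijective.
ranking : ∀ {n} (f : Fin n → ℚ) → (∀ i j → i ≢ j → f i ≢ f j) → Ranking f
ranking {n} f distinct = record { r = r ; σ = σ ; r∘σ = r∘σ ; σ∘r = λ i → inj (r∘σ (r i)) ; anti = anti }
  where
  above : ∀ i j → Dec (f i < f j)
  above i j = f i <? f j
  rank<n : ∀ i → count (above i) ℕ.< n
  -- The count is compared with that of an always true predicate; it is strictly smaller because `i`
  -- does not count itself.
  rank<n i = ℕ.<-≤-trans (count-mono-< {Q = λ _ → f i ≡ f i} (above i) (λ _ → yes refl) (λ _ _ → refl) i (<-irrefl refl) refl) (count≤n {P = λ _ → f i ≡ f i} (λ _ → yes refl))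
  r : Fin n → Fin n
  r i = Fin.fromℕ< (rank<n i)
  anti : ∀ i j → f j < f i → toℕ (r i) ℕ.< toℕ (r j)
  anti i j fj<fi = subst₂ ℕ._<_ (sym (Fin.toℕ-fromℕ< (rank<n i))) (sym (Fin.toℕ-fromℕ< (rank<n j)))
    (count-mono-< (above i) (above j) (λ _ → <-trans fj<fi) i (<-irrefl refl) fj<fi)
  inj : ∀ {i j} → r i ≡ r j → i ≡ j
  inj {i} {j} eq with i Fin.≟ j
  ... | yes i≡j = i≡j
  ... | no  i≢j with <-cmp (f i) (f j)
  ... | tri< fi<fj _ _ = ⊥-elim (ℕ.<-irrefl (cong toℕ (sym eq)) (anti j i fi<fj))
  ... | tri≈ _ fi≡fj _ = contradiction fi≡fj (distinct i j i≢j)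
  ... | tri> _ _ fj<fi = ⊥-elim (ℕ.<-irrefl (cong toℕ eq) (anti i j fj<fi))
  σ : Fin n → Fin n
  σ a = proj₁ (injective⇒surjective r inj a)
  r∘σ : ∀ a → r (σ a) ≡ a
  r∘σ a = proj₂ (injective⇒surjective r inj a)

-- Vertices and barycentric coordinates of a region

IsInt-root : ∀ {n} {x : Pt n} → InΛ x → ∀ i j → IsInt (root i j x)
IsInt-root {x = x} (_ , int) i j = case i Fin.≟ j of λ where
  (yes refl) → ℤ.0ℤ , +-inverseʳ (x i)
  (no i≢j)   → int i j i≢j

-- A closed region presented as a simplex, with its barycentric coordinates given as functions on
-- all of `Pt (suc d)`. Unimodularity and the absence of further lattice points both come from
-- `int-coord`.
record Alcove {d} (k : Fin (suc d) → Fin (suc d) → ℤ) : Set where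
  field
    W         : Fin (suc d) → Pt (suc d)
    coord     : Fin (suc d) → Pt (suc d) → ℚ
    W∈Λ       : ∀ l → InΛ (W l)
    W-slabs   : ∀ l → InSlabs k (W l)
    aff-ind   : AffInd W
    sum-coord : ∀ x → sumℚ (λ l → coord l x) ≡ 1ℚ
    expand    : ∀ x → InV x → x ≐ lincomb (λ l → coord l x) W
    0≤coord   : ∀ x → InSlabs k x → ∀ l → 0ℚ ≤ coord l x
    int-coord : ∀ x → InΛ x → ∀ l → IsInt (coord l x)

-- The indicator of `a < b`, given by recursion so that `step-suc` holds by computation.
step : ℕ → ℕ → ℤ
step _       zero    = ℤ.+ 0
step zero    (suc b) = ℤ.+ 1
step (suc a) (suc b) = step a b

step-< : ∀ {a b} → a ℕ.< b → step a b ≡ ℤ.+ 1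
step-< {zero}  {suc b} _ = refl
step-< {suc a} {suc b} (s<s a<b) = step-< a<b

step-≥ : ∀ {a b} → b ℕ.≤ a → step a b ≡ ℤ.+ 0
step-≥ {a}     {zero}  _ = refl
step-≥ {suc a} {suc b} (ℕ.s≤s b≤a) = step-≥ b≤a

step-suc : ∀ {n} (q : Fin n) (p : Fin (suc n)) →
           ι (step (toℕ q) (toℕ p)) - ι (step (suc (toℕ q)) (toℕ p)) ≡ e (suc q) p
step-suc q       zero    = refl
step-suc zero    (suc zero) = refl
step-suc zero    (suc (suc p)) = refl
step-suc (suc q) (suc p) = step-suc q p

-- The orthogonal projection to `V`; subtracting a constant vector changes no root, so integrality
-- and slabs can be checked before centring.
centre : ∀ {d} → Pt (suc d) → Pt (suc d)
centre u i = u i - mean u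

centre-InV : ∀ {d} (u : Pt (suc d)) → InV (centre u)
centre-InV {d} u = *≡0 {s} {sumℚ (centre u)} (trans (mean-shift (mean u) u) (+-inverseʳ (mean u))) (<-absurd (proj₁ (proj₂ (1/N d))))
  where s = proj₁ (1/N d)

telescope : ∀ {d} (g : Fin (suc d) → ℚ) → sumℚ (λ q → g (Fin.inject₁ q) - g (suc q)) ≡ g zero - g (Fin.fromℕ d)
telescope {zero}  g = sym (+-inverseʳ (g zero))
telescope {suc d} g = begin
  g zero - g (suc zero) + sumℚ (λ q → g (suc (Fin.inject₁ q)) - g (suc (suc q)))  ≡⟨ cong (g zero - g (suc zero) +_) (telescope (g ∘ suc)) ⟩
  g zero - g (suc zero) + (g (suc zero) - g (suc (Fin.fromℕ d)))
    ≡⟨ solve 3 (λ a b c → a :- b :+ (b :- c) := a :- c) refl (g zero) (g (suc zero)) (g (suc (Fin.fromℕ d))) ⟩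
  g zero - g (suc (Fin.fromℕ d)) ∎
  where open ≡-Reasoning

consecutive-≡ : ∀ {d} (g : Fin (suc d) → ℚ) → (∀ q → g (Fin.inject₁ q) ≡ g (suc q)) → ∀ q → g q ≡ g zero
consecutive-≡ g eq zero = refl
consecutive-≡ {suc d} g eq (suc q) = trans (consecutive-≡ (g ∘ suc) (eq ∘ suc) q) (sym (eq zero))

InV-constant : ∀ {d} (x : Pt (suc d)) → InV x → (∀ i → x i ≡ x zero) → ∀ i → x i ≡ 0ℚ
InV-constant {d} x x∈V const i = trans (const i) (*≡0 (begin
  sumℚ (𝟙 {suc d}) * x zero       ≡⟨ *-comm (sumℚ (𝟙 {suc d})) (x zero) ⟩
  x zero * sumℚ (𝟙 {suc d})       ≡⟨ sum-* (x zero) (𝟙 {suc d}) ⟨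
  sumℚ (λ (i : Fin (suc d)) → x zero * 1ℚ) ≡⟨ sum-cong (λ i → trans (*-identityʳ (x zero)) (sym (const i))) ⟩
  sumℚ x                          ≡⟨ x∈V ⟩
  0ℚ ∎) (<-absurd (0<sum-𝟙 d)))
  where open ≡-Reasoning

ι-squeeze : ∀ a b {q} → ι a < q → q < ι a + 1ℚ → ι b < q → q < ι b + 1ℚ → ι a ≡ ι b
ι-squeeze a b a<q q<a+1 b<q q<b+1 = ≤-antisym
  (≮⇒≥ (λ b<a → <-irrefl refl (<-≤-trans (<-trans a<q q<b+1) (ι-discrete b a b<a))))
  (≮⇒≥ (λ a<b → <-irrefl refl (<-≤-trans (<-trans b<q q<a+1) (ι-discrete a b a<b))))

ι-minus : ∀ a b → ι (a ℤ.- b) ≡ ι a - ι b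
ι-minus a b = trans (ι-+ a (ℤ.- b)) (cong (ι a +_) (ι-neg b))

IsInt-minus : ∀ {p q} → IsInt p → IsInt q → IsInt (p - q)
IsInt-minus (a , refl) (b , refl) = a ℤ.- b , sym (ι-minus a b)

module FractionalParts {d} (k : Fin (suc d) → Fin (suc d) → ℤ) (y : Pt (suc d)) (y-open : InOpenSlabs k y) where

  open ≡-Reasoning

  m : Fin (suc d) → ℤ
  m i = proj₁ (floor-spec (y i))
  f : Fin (suc d) → ℚ
  f i = y i - ι (m i)
  0≤f : ∀ i → 0ℚ ≤ f i
  0≤f i = 0≤- (proj₁ (proj₂ (floor-spec (y i))))
  0<1-f : ∀ i → 0ℚ < ι (m i) + 1ℚ - y i
  0<1-f i = 0<- (proj₂ (proj₂ (floor-spec (y i))))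

  -- Equal fractional parts would make `root i j y` an integer strictly inside an open slab.
  f-distinct : ∀ i j → i ≢ j → f i ≢ f j
  f-distinct i j i≢j eq = no-integer-between (k i j) (m i ℤ.- m j)
      (subst (ι (k i j) <_) y≡ (proj₁ (y-open i j i≢j))) (subst (_< ι (k i j) + 1ℚ) y≡ (proj₂ (y-open i j i≢j)))
    where
    y≡ : root i j y ≡ ι (m i ℤ.- m j)
    y≡ = ≡-by (0≡- eq) (begin
      y i - ι (m i) - (y j - ι (m j))
        ≡⟨ solve 4 (λ a b c d → a :- b :- (c :- d) := a :- c :- (b :- d)) refl (y i) (ι (m i)) (y j) (ι (m j)) ⟩
      root i j y - (ι (m i) - ι (m j))   ≡⟨ cong (λ u → root i j y - u) (ι-minus (m i) (m j)) ⟨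
      root i j y - ι (m i ℤ.- m j) ∎)

module RegionVertices {d} (k : Fin (suc d) → Fin (suc d) → ℤ) (y : Pt (suc d)) (y-open : InOpenSlabs k y)
                      (ranked : Ranking (FractionalParts.f k y y-open)) where

  open ≡-Reasoning
  open FractionalParts k y y-open
  open Ranking ranked

  r≢ : ∀ {i j} → toℕ (r i) ℕ.< toℕ (r j) → i ≢ j
  r≢ ri<rj refl = ℕ.<-irrefl refl ri<rj

  f-anti : ∀ {i j} → toℕ (r i) ℕ.< toℕ (r j) → f j < f i
  f-anti {i} {j} ri<rj = case <-cmp (f i) (f j) of λ where
    (tri< fi<fj _ _) → ⊥-elim (ℕ.<-asym ri<rj (anti j i fi<fj))
    (tri≈ _ fi≡fj _) → contradiction fi≡fj (f-distinct i j (r≢ ri<rj))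
    (tri> _ _ fj<fi) → fj<fi

  -- Here `f j < f i`, so `root i j y` exceeds `m i - m j` by a number strictly between `0` and `1`.
  -- In `k-down` that difference is negative, and one unit is borrowed.
  k-up : ∀ {i j} → toℕ (r i) ℕ.< toℕ (r j) → ι (k i j) ≡ ι (m i) - ι (m j)
  k-up {i} {j} ri<rj = trans
    (ι-squeeze (k i j) (m i ℤ.- m j) (proj₁ (y-open i j i≢j)) (proj₂ (y-open i j i≢j))
      (<-by (0<- (f-anti ri<rj)) (trans (y i - ι (m i) - (y j - ι (m j)) ≡ root i j y - (ι (m i) - ι (m j)) ∋
            solve 4 (λ a b c d → a :- b :- (c :- d) := a :- c :- (b :- d))
              refl (y i) (ι (FractionalParts.m k y y-open i)) (y j) (ι (FractionalParts.m k y y-open j)))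
        (cong (λ u → root i j y - u) (sym (ι-minus (m i) (m j))))))
      (<-by (0<+ (0<1-f i) (0≤f j)) (trans (ι (m i) + 1ℚ - y i + (y j - ι (m j)) ≡ ι (m i) - ι (m j) + 1ℚ - root i j y ∋
            solve 4 (λ a b c d → a :+ con 1ℚ :- b :+ (c :- d) := a :- d :+ con 1ℚ :- (b :- c))
              refl (ι (FractionalParts.m k y y-open i)) (y i) (y j) (ι (FractionalParts.m k y y-open j)))
        (cong (λ u → u + 1ℚ - root i j y) (sym (ι-minus (m i) (m j)))))))
    (ι-minus (m i) (m j))
    where i≢j = r≢ ri<rj

  k-down : ∀ {i j} → toℕ (r j) ℕ.< toℕ (r i) → ι (k i j) ≡ ι (m i) - ι (m j) - 1ℚ
  k-down {i} {j} rj<ri = trans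
    (ι-squeeze (k i j) (m i ℤ.- m j ℤ.- ℤ.+ 1) (proj₁ (y-open i j i≢j)) (proj₂ (y-open i j i≢j))
      (<-by (0<+ (0<1-f j) (0≤f i)) (trans (ι (m j) + 1ℚ - y j + (y i - ι (m i)) ≡ root i j y - (ι (m i) - ι (m j) - 1ℚ) ∋
            solve 4 (λ a b c d → a :+ con 1ℚ :- b :+ (c :- d) := c :- b :- (d :- a :- con 1ℚ))
              refl (ι (FractionalParts.m k y y-open j)) (y j) (y i) (ι (FractionalParts.m k y y-open i)))
        (cong (λ u → root i j y - u) (sym ι≡))))
      (<-by (0<- (f-anti rj<ri)) (trans (y j - ι (m j) - (y i - ι (m i)) ≡ ι (m i) - ι (m j) - 1ℚ + 1ℚ - root i j y ∋
            solve 4 (λ a b c d → a :- b :- (c :- d) := d :- b :- con 1ℚ :+ con 1ℚ :- (c :- a))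
              refl (y j) (ι (FractionalParts.m k y y-open j)) (y i) (ι (FractionalParts.m k y y-open i)))
        (cong (λ u → u + 1ℚ - root i j y) (sym ι≡)))))
    ι≡
    where
    i≢j = r≢ rj<ri ∘ sym
    ι≡ : ι (m i ℤ.- m j ℤ.- ℤ.+ 1) ≡ ι (m i) - ι (m j) - 1ℚ
    ι≡ = trans (ι-minus (m i ℤ.- m j) (ℤ.+ 1)) (cong (_- 1ℚ) (ι-minus (m i) (m j)))

  χ : Fin (suc d) → Fin (suc d) → ℤ
  χ l i = step (toℕ (r i)) (toℕ l)

  -- The vertices arise from (m i)ᵢ by adding 1 successively in the coordinates σ 0, σ 1, …
  W : Fin (suc d) → Pt (suc d)
  W l = centre (λ i → ι (m i ℤ.+ χ l i))

  root-W : ∀ l i j → root i j (W l) ≡ ι (m i) - ι (m j) + (ι (χ l i) - ι (χ l j))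
  root-W l i j = begin
    ι (m i ℤ.+ χ l i) - M - (ι (m j ℤ.+ χ l j) - M)        ≡⟨ cong₂ (λ u v → u - M - (v - M)) (ι-+ (m i) (χ l i)) (ι-+ (m j) (χ l j)) ⟩
    ι (m i) + ι (χ l i) - M - (ι (m j) + ι (χ l j) - M)
      ≡⟨ solve 5 (λ a b c d e → a :+ b :- c :- (d :+ e :- c) := a :- d :+ (b :- e))
           refl (ι (FractionalParts.m k y y-open i)) (ι (χ l i)) M (ι (FractionalParts.m k y y-open j)) (ι (χ l j)) ⟩
    ι (m i) - ι (m j) + (ι (χ l i) - ι (χ l j)) ∎
    where M = mean (λ i → ι (m i ℤ.+ χ l i))

  W∈Λ : ∀ l → InΛ (W l)
  W∈Λ l = centre-InV (λ i → ι (m i ℤ.+ χ l i)) , λ i j _ →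
    (m i ℤ.+ χ l i) ℤ.- (m j ℤ.+ χ l j) , (begin
      ι (m i ℤ.+ χ l i) - M - (ι (m j ℤ.+ χ l j) - M)
        ≡⟨ solve 3 (λ a b c → a :- b :- (c :- b) := a :- c)
             refl (ι (FractionalParts.m k y y-open i ℤ.+ χ l i)) M (ι (FractionalParts.m k y y-open j ℤ.+ χ l j)) ⟩
      ι (m i ℤ.+ χ l i) - ι (m j ℤ.+ χ l j)            ≡⟨ ι-minus (m i ℤ.+ χ l i) (m j ℤ.+ χ l j) ⟨
      ι ((m i ℤ.+ χ l i) ℤ.- (m j ℤ.+ χ l j)) ∎)
    where M = mean (λ i → ι (m i ℤ.+ χ l i))

  χ-step : ∀ {a b} → a ℕ.< b → ∀ l → 0ℚ ≤ ι (step a l) - ι (step b l) × 0ℚ ≤ 1ℚ - (ι (step a l) - ι (step b l))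
  χ-step {a} {b} a<b l with a ℕ.<? l | b ℕ.<? l
  ... | yes a<l | yes b<l rewrite step-< a<l | step-< b<l = ≤-refl , 0≤1
  ... | yes a<l | no  b≮l rewrite step-< a<l | step-≥ (ℕ.≮⇒≥ b≮l) = 0≤1 , ≤-refl
  ... | no  a≮l | yes b<l = contradiction (ℕ.<-trans a<b b<l) a≮l
  ... | no  a≮l | no  b≮l rewrite step-≥ (ℕ.≮⇒≥ a≮l) | step-≥ (ℕ.≮⇒≥ b≮l) = ≤-refl , 0≤1

  rank-cmp : ∀ {i j} → i ≢ j → toℕ (r i) ℕ.< toℕ (r j) ⊎ toℕ (r j) ℕ.< toℕ (r i)
  rank-cmp {i} {j} i≢j with ℕ.<-cmp (toℕ (r i)) (toℕ (r j))
  ... | tri< p _ _ = inj₁ p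
  ... | tri≈ _ p _ = contradiction (trans (sym (σ∘r i)) (trans (cong σ (Fin.toℕ-injective p)) (σ∘r j))) i≢j
  ... | tri> _ _ p = inj₂ p

  W-slabs : ∀ l → InSlabs k (W l)
  W-slabs l i j i≢j = case rank-cmp i≢j of λ where
      (inj₁ ri<rj) → within (χᵢ - χⱼ) (χ-step ri<rj (toℕ l)) (begin
        root i j (W l) - ι (k i j)                ≡⟨ cong₂ _-_ (root-W l i j) (k-up ri<rj) ⟩
        μᵢ - μⱼ + (χᵢ - χⱼ) - (μᵢ - μⱼ)
          ≡⟨ solve 4 (λ a b c d → a :- b :+ (c :- d) :- (a :- b) := c :- d) refl μᵢ μⱼ χᵢ χⱼ ⟩
        χᵢ - χⱼ ∎)
      (inj₂ rj<ri) → within (1ℚ - (χⱼ - χᵢ)) (flip (χ-step rj<ri (toℕ l))) (begin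
        root i j (W l) - ι (k i j)                ≡⟨ cong₂ _-_ (root-W l i j) (k-down rj<ri) ⟩
        μᵢ - μⱼ + (χᵢ - χⱼ) - (μᵢ - μⱼ - 1ℚ)
          ≡⟨ solve 4 (λ a b c d → a :- b :+ (c :- d) :- (a :- b :- con 1ℚ) := con 1ℚ :- (d :- c))
               refl μᵢ μⱼ χᵢ χⱼ ⟩
        1ℚ - (χⱼ - χᵢ) ∎)
    where
    χᵢ = ι (χ l i)
    χⱼ = ι (χ l j)
    μᵢ = ι (m i)
    μⱼ = ι (m j)
    flip : ∀ {δ} → 0ℚ ≤ δ × 0ℚ ≤ 1ℚ - δ → 0ℚ ≤ 1ℚ - δ × 0ℚ ≤ 1ℚ - (1ℚ - δ)
    flip {δ} (lo , hi) = hi , subst (0ℚ ≤_) (δ ≡ 1ℚ - (1ℚ - δ) ∋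
          solve 1 (λ a → a := con 1ℚ :- (con 1ℚ :- a)) refl δ) lo
    within : ∀ δ → 0ℚ ≤ δ × 0ℚ ≤ 1ℚ - δ → root i j (W l) - ι (k i j) ≡ δ →
             (ι (k i j) ≤ root i j (W l)) × (root i j (W l) ≤ ι (k i j ℤ.+ ℤ.+ 1))
    within δ (lo , hi) eq = ≤-by lo (sym eq) , subst (root i j (W l) ≤_) (sym (ι-suc (k i j)))
      (≤-by hi (trans (cong (λ u → 1ℚ - u) (sym eq)) (rearrange (root i j (W l)) (ι (k i j)))))
      where
      rearrange : ∀ R K → 1ℚ - (R - K) ≡ K + 1ℚ - R
      rearrange R K = (solve 2 (λ a b → con 1ℚ :- (a :- b) := b :+ con 1ℚ :- a) refl R K)

  -- The barycentric coordinates are the affine functions measuring the distance to the d + 1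
  -- walls x (σ (l - 1)) - x (σ l) of the region, where l - 1 is read cyclically.
  previous : Fin (suc d) → Fin (suc d)
  previous zero    = σ (Fin.fromℕ d)
  previous (suc q) = σ (Fin.inject₁ q)

  -- Only the wall that closes the cycle, from the last coordinate in the order back to the first,
  -- is shifted by one unit.
  wrap : Fin (suc d) → ℚ
  wrap zero    = 1ℚ
  wrap (suc q) = 0ℚ

  offset : Fin (suc d) → ℚ
  offset l = wrap l - (ι (m (previous l)) - ι (m (σ l)))

  coord : Fin (suc d) → Pt (suc d) → ℚ
  coord l x = root (previous l) (σ l) x + offset l

  -- The integral parts cancel, which leaves the indicator difference `[q < p] - [q + 1 < p]` for
  -- `l = suc q`, and `0 - [0 < p] + 1` for the closing wall.
  coord-W : ∀ l p → coord l (W p) ≡ e l p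
  coord-W l p = begin
    root (previous l) (σ l) (W p) + offset l   ≡⟨ cong (_+ offset l) (root-W p (previous l) (σ l)) ⟩
    ι (m (previous l)) - ι (m (σ l)) + (ι (χ p (previous l)) - ι (χ p (σ l))) + (wrap l - (ι (m (previous l)) - ι (m (σ l))))
      ≡⟨ solve 5 (λ a b c d e → a :- b :+ (c :- d) :+ (e :- (a :- b)) := c :- d :+ e)
            refl (ι (FractionalParts.m k y y-open (previous l))) (ι (FractionalParts.m k y y-open (Ranking.σ ranked l))) (ι (χ p (previous l))) (ι (χ p (Ranking.σ ranked l))) (wrap l) ⟩
    ι (χ p (previous l)) - ι (χ p (σ l)) + wrap l  ≡⟨ indicator l p ⟩
    e l p ∎
    where
    indicator : ∀ l p → ι (χ p (previous l)) - ι (χ p (σ l)) + wrap l ≡ e l p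
    indicator (suc q) p = begin
      ι (χ p (σ (Fin.inject₁ q))) - ι (χ p (σ (suc q))) + 0ℚ
        ≡⟨ cong₂ (λ a b → ι (step a (toℕ p)) - ι (step b (toℕ p)) + 0ℚ)
             (trans (cong toℕ (r∘σ (Fin.inject₁ q))) (Fin.toℕ-inject₁ q)) (cong toℕ (r∘σ (suc q))) ⟩
      ι (step (toℕ q) (toℕ p)) - ι (step (suc (toℕ q)) (toℕ p)) + 0ℚ
        ≡⟨ trans (+-identityʳ (ι (step (toℕ q) (toℕ p)) - ι (step (suc (toℕ q)) (toℕ p)))) (step-suc q p) ⟩
      e (suc q) p ∎
    indicator zero p = begin
      ι (χ p (σ (Fin.fromℕ d))) - ι (χ p (σ zero)) + 1ℚ
        ≡⟨ cong₂ (λ a b → ι (step a (toℕ p)) - ι (step b (toℕ p)) + 1ℚ)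
             (trans (cong toℕ (r∘σ (Fin.fromℕ d))) (Fin.toℕ-fromℕ d)) (cong toℕ (r∘σ zero)) ⟩
      ι (step d (toℕ p)) - ι (step 0 (toℕ p)) + 1ℚ
        ≡⟨ cong (λ u → ι u - ι (step 0 (toℕ p)) + 1ℚ) (step-≥ (Fin.toℕ≤pred[n] p)) ⟩
      0ℚ - ι (step 0 (toℕ p)) + 1ℚ
        ≡⟨ first p ⟩
      e zero p ∎
      where
      first : ∀ {n} (p : Fin (suc n)) → 0ℚ - ι (step 0 (toℕ p)) + 1ℚ ≡ e zero p
      first zero    = refl
      first (suc p) = refl

  -- Multiplying `offset` by the sum of `c` makes the identity linear in `c`; sum `0` then yields
  -- affine independence, and sum `1` yields `expand`.
  coord-lincomb : ∀ c l → root (previous l) (σ l) (lincomb c W) + offset l * sumℚ c ≡ c l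
  coord-lincomb c l = begin
    root (previous l) (σ l) (lincomb c W) + offset l * sumℚ c
      ≡⟨ cong (_+ offset l * sumℚ c) (root-lincomb (previous l) (σ l) c W) ⟩
    sumℚ (λ p → c p * root (previous l) (σ l) (W p)) + offset l * sumℚ c
      ≡⟨ sum-+* (λ p → c p * root (previous l) (σ l) (W p)) (offset l) c ⟨
    sumℚ (λ p → c p * root (previous l) (σ l) (W p) + offset l * c p)
      ≡⟨ sum-cong (λ p → trans
           (c p * root (previous l) (σ l) (W p) + offset l * c p ≡ (root (previous l) (σ l) (W p) + offset l) * c p ∋
                 solve 4 (λ a b c d → a :* (b :- c) :+ d :* a := (b :- c :+ d) :* a)
                   refl (c p) (W p (previous l)) (W p (Ranking.σ ranked l)) (offset l))
           (cong (_* c p) (coord-W l p))) ⟩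
    ⟨ e l , c ⟩  ≡⟨ dot-e l c ⟩
    c l ∎

  aff-ind : AffInd W
  aff-ind c sum≡0 cW≡0 l = begin
    c l                                                          ≡⟨ coord-lincomb c l ⟨
    lincomb c W (previous l) - lincomb c W (σ l) + offset l * sumℚ c
      ≡⟨ cong₂ (λ u v → u + offset l * v) (cong₂ _-_ (cW≡0 (previous l)) (cW≡0 (σ l))) sum≡0 ⟩
    0ℚ - 0ℚ + offset l * 0ℚ
      ≡⟨ solve 1 (λ a → con 0ℚ :- con 0ℚ :+ a :* con 0ℚ := con 0ℚ) refl (offset l) ⟩
    0ℚ ∎

  -- The coordinates at successors telescope and the coordinate at `zero` closes the cycle, so only
  -- `wrap zero` survives.
  sum-coord : ∀ x → sumℚ (λ l → coord l x) ≡ 1ℚ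
  sum-coord x = begin
    coord zero x + sumℚ (λ q → coord (suc q) x)
      ≡⟨ cong (coord zero x +_) (trans (sum-cong λ q →
           x (σ (Fin.inject₁ q)) - x (σ (suc q)) + (0ℚ - (ι (m (σ (Fin.inject₁ q))) - ι (m (σ (suc q)))))
             ≡ (x (σ (Fin.inject₁ q)) - ι (m (σ (Fin.inject₁ q)))) - (x (σ (suc q)) - ι (m (σ (suc q)))) ∋
                   solve 4 (λ a b c d → a :- b :+ (con 0ℚ :- (c :- d)) := a :- c :- (b :- d))
                     refl (x (Ranking.σ ranked (Fin.inject₁ q))) (x (Ranking.σ ranked (suc q))) (ι (FractionalParts.m k y y-open (Ranking.σ ranked (Fin.inject₁ q)))) (ι (FractionalParts.m k y y-open (Ranking.σ ranked (suc q)))))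
           (telescope (λ q → x (σ q) - ι (m (σ q))))) ⟩
    x a - x b + (1ℚ - (ι (m a) - ι (m b))) + (x b - ι (m b) - (x a - ι (m a)))
      ≡⟨ solve 4 (λ a b c d → a :- b :+ (con 1ℚ :- (c :- d)) :+ (b :- d :- (a :- c)) := con 1ℚ)
            refl (x a) (x b) (ι (FractionalParts.m k y y-open a)) (ι (FractionalParts.m k y y-open b)) ⟩
    1ℚ ∎
    where
    a = σ (Fin.fromℕ d)
    b = σ zero

  -- By `coord-lincomb` the difference of the two sides has equal entries at consecutive positions
  -- of the order. It is thus a constant vector, and the only one in `V` is `0`.
  expand : ∀ x → InV x → x ≐ lincomb (λ l → coord l x) W
  expand x x∈V i = ≡-by (InV-constant z z∈V constant i) refl
    where
    c : Fin (suc d) → ℚ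
    c l = coord l x
    z : Pt (suc d)
    z i = x i - lincomb c W i
    z∈V : InV z
    z∈V = trans (sum-minus x (lincomb c W)) (cong₂ _-_ x∈V (lincomb-InV c W (λ l → proj₁ (W∈Λ l))))
    consecutive : ∀ q → z (σ (Fin.inject₁ q)) ≡ z (σ (suc q))
    consecutive q = ≡-by (0≡- (sym (coord-lincomb c (suc q)))) (begin
      root a b x + β - (root a b (lincomb c W) + β * sumℚ c)   ≡⟨ cong (λ u → root a b x + β - (root a b (lincomb c W) + β * u)) (sum-coord x) ⟩
      root a b x + β - (root a b (lincomb c W) + β * 1ℚ)
        ≡⟨ solve 5 (λ a b c d e → a :- b :+ c :- (d :- e :+ c :* con 1ℚ) := a :- d :- (b :- e))
             refl (x a) (x b) β (lincomb c W a) (lincomb c W b) ⟩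
      x a - lincomb c W a - (x b - lincomb c W b) ∎)
      where
      a = σ (Fin.inject₁ q)
      b = σ (suc q)
      β = offset (suc q)
    constant : ∀ i → z i ≡ z zero
    constant i = trans (at i) (sym (at zero))
      where
      at : ∀ i → z i ≡ z (σ zero)
      at i = trans (cong z (sym (σ∘r i))) (consecutive-≡ (z ∘ σ) consecutive (r i))

  0≤coord : ∀ x → InSlabs k x → ∀ l → 0ℚ ≤ coord l x
  0≤coord x x∈ (suc q) = ≤-by (0≤- (proj₁ (x∈ a b (r≢ ra<rb)))) (trans (cong (λ u → root a b x - u) (k-up ra<rb))
      (root a b x - (ι (m a) - ι (m b)) ≡ root a b x + (0ℚ - (ι (m a) - ι (m b))) - 0ℚ ∋
            solve 4 (λ a b c d → a :- b :- (c :- d) := a :- b :+ (con 0ℚ :- (c :- d)) :- con 0ℚ)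
              refl (x a) (x b) (ι (FractionalParts.m k y y-open a)) (ι (FractionalParts.m k y y-open b))))
    where
    a = σ (Fin.inject₁ q)
    b = σ (suc q)
    ra<rb : toℕ (r a) ℕ.< toℕ (r b)
    ra<rb = subst₂ ℕ._<_ (sym (trans (cong toℕ (r∘σ (Fin.inject₁ q))) (Fin.toℕ-inject₁ q))) (sym (cong toℕ (r∘σ (suc q)))) (ℕ.n<1+n (toℕ q))
  0≤coord x x∈ zero = case toℕ (r b) ℕ.<? toℕ (r a) of λ where
      (yes rb<ra) → ≤-by (0≤- (proj₁ (x∈ a b (r≢ rb<ra ∘ sym)))) (trans (cong (λ u → root a b x - u) (k-down rb<ra))
        (root a b x - (ι (m a) - ι (m b) - 1ℚ) ≡ root a b x + (1ℚ - (ι (m a) - ι (m b))) - 0ℚ ∋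
              solve 4 (λ a b c d → a :- b :- (c :- d :- con 1ℚ) := a :- b :+ (con 1ℚ :- (c :- d)) :- con 0ℚ)
                refl (x a) (x b) (ι (FractionalParts.m k y y-open a)) (ι (FractionalParts.m k y y-open b))))
      -- This occurs only for `d = 0`, where the first and the last coordinate coincide and
      -- `coord zero` is constantly `1`.
      (no rb≮ra) → subst (λ a → 0ℚ ≤ root a b x + (1ℚ - (ι (m a) - ι (m b)))) (b≡a rb≮ra)
        (≤-by 0≤1 (1ℚ ≡ root b b x + (1ℚ - (ι (m b) - ι (m b))) - 0ℚ ∋
              solve 2 (λ a b → con 1ℚ := a :- a :+ (con 1ℚ :- (b :- b)) :- con 0ℚ)
                refl (x b) (ι (FractionalParts.m k y y-open b))))
    where
    a = σ (Fin.fromℕ d)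
    b = σ zero
    b≡a : ¬ (toℕ (r b) ℕ.< toℕ (r a)) → b ≡ a
    b≡a rb≮ra = cong σ 0≡last
      where
      0≡last : zero ≡ Fin.fromℕ d
      0≡last = Fin.toℕ-injective (sym (ℕ.n≤0⇒n≡0 (subst₂ ℕ._≤_ (cong toℕ (r∘σ (Fin.fromℕ d))) (cong toℕ (r∘σ zero)) (ℕ.≮⇒≥ rb≮ra))))

  int-coord : ∀ x → InΛ x → ∀ l → IsInt (coord l x)
  int-coord x x∈Λ l = subst IsInt (root (previous l) (σ l) x - (ι (m (previous l)) - ι (m (σ l)) - wrap l)
      ≡ root (previous l) (σ l) x + (wrap l - (ι (m (previous l)) - ι (m (σ l)))) ∋
            solve 5 (λ a b c d e → a :- b :- (c :- d :- e) := a :- b :+ (e :- (c :- d)))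
              refl (x (previous l)) (x (Ranking.σ ranked l)) (ι (FractionalParts.m k y y-open (previous l))) (ι (FractionalParts.m k y y-open (Ranking.σ ranked l))) (wrap l))
    (IsInt-minus (IsInt-root {x = x} x∈Λ (previous l) (σ l)) (IsInt-minus (IsInt-minus (m (previous l) , refl) (m (σ l) , refl)) (int-wrap l)))
    where
    int-wrap : ∀ l → IsInt (wrap l)
    int-wrap zero    = ℤ.+ 1 , refl
    int-wrap (suc q) = ℤ.+ 0 , refl

alcove : ∀ {d} (k : Fin (suc d) → Fin (suc d) → ℤ) (y : Pt (suc d)) → InOpenSlabs k y → Alcove k
alcove k y y-open = record { RegionVertices k y y-open (ranking f f-distinct) }
  where open FractionalParts k y y-open

-- Convex combinations of the vertices of a region

root-≐ : ∀ {n} {x y : Pt n} → x ≐ y → ∀ i j → root i j x ≡ root i j y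
root-≐ x≐y i j = cong₂ _-_ (x≐y i) (x≐y j)

InSlabs-≐ : ∀ {n} {k} {x y : Pt n} → x ≐ y → InSlabs k y → InSlabs k x
InSlabs-≐ {k = k} {x} {y} x≐y slabs i j i≢j =
  subst (λ u → (ι (k i j) ≤ u) × (u ≤ ι (k i j ℤ.+ ℤ.+ 1))) (sym (root-≐ {x = x} {y} x≐y i j)) (slabs i j i≢j)

InΛ-≐ : ∀ {n} {x y : Pt n} → x ≐ y → InΛ y → InΛ x
InΛ-≐ {x = x} {y} x≐y (y∈V , int) = trans (sum-cong x≐y) y∈V ,
  λ i j i≢j → subst IsInt (sym (root-≐ {x = x} {y} x≐y i j)) (int i j i≢j)

Conv-≐ : ∀ {m n} {vs : Fin m → Pt n} {x y : Pt n} → x ≐ y → Conv vs y → Conv vs x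
Conv-≐ x≐y (c , 0≤c , sum≡1 , y≐) = c , 0≤c , sum≡1 , λ i → trans (x≐y i) (y≐ i)

root-comb : ∀ {m n} {W : Fin m → Pt n} {c x} → ConvComb W c x → ∀ i j a →
            sumℚ (λ l → c l * (root i j (W l) - a)) ≡ root i j x - a
root-comb {W = W} {c} {x} (_ , sum≡1 , x≐) i j a = begin
  sumℚ (λ l → c l * (root i j (W l) - a))
    ≡⟨ sum-cong (λ l → c l * (root i j (W l) - a) ≡ c l * root i j (W l) + - a * c l ∋
          solve 4 (λ a b c d → a :* (b :- c :- d) := a :* (b :- c) :+ (:- d) :* a)
            refl (c l) (W l i) (W l j) a) ⟩
  sumℚ (λ l → c l * root i j (W l) + - a * c l)
    ≡⟨ sum-+* (λ l → c l * root i j (W l)) (- a) c ⟩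
  sumℚ (λ l → c l * root i j (W l)) + - a * sumℚ c
    ≡⟨ cong₂ (λ u v → u + - a * v) (sym (trans (root-≐ {x = x} {lincomb c W} x≐ i j) (root-lincomb i j c W))) sum≡1 ⟩
  root i j x + - a * 1ℚ
    ≡⟨ solve 3 (λ a b c → a :- b :+ (:- c) :* con 1ℚ := a :- b :- c) refl (x i) (x j) a ⟩
  root i j x - a ∎
  where open ≡-Reasoning

LowerBound : ∀ {n} → Pt n → Fin n → Fin n → ℤ → Set
LowerBound x i j z = ι z ≤ root i j x

-- An upper bound on a root is a lower bound on the opposite root, so the arguments below treat
-- lower bounds only.
upper⇒lower : ∀ {n} (x : Pt n) i j z → root i j x ≤ ι z → LowerBound x j i (ℤ.- z)
upper⇒lower x i j z x≤z = ≤-by (0≤- x≤z) (trans (ι z - root i j x ≡ root j i x - - ι z ∋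
      solve 3 (λ a b c → a :- (b :- c) := c :- b :- (:- a)) refl (ι z) (x i) (x j))
  (cong (λ u → root j i x - u) (sym (ι-neg z))))

lower⇒upper : ∀ {n} (x : Pt n) i j z → LowerBound x j i (ℤ.- z) → root i j x ≤ ι z
lower⇒upper x i j z -z≤x = ≤-by (0≤- -z≤x) (trans (cong (λ u → root j i x - u) (ι-neg z))
  (root j i x - - ι z ≡ ι z - root i j x ∋
        solve 3 (λ a b c → a :- b :- (:- c) := c :- (b :- a)) refl (x j) (x i) (ι z)))

lower-comb : ∀ {m n} {W : Fin m → Pt n} {c x} → ConvComb W c x → ∀ i j z →
             (∀ l → c l ≢ 0ℚ → LowerBound (W l) i j z) → LowerBound x i j z
lower-comb {W = W} {c} comb@(0≤c , _) i j z lower = ≤-by (sum-nonneg nonneg) (root-comb {W = W} comb i j (ι z))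
  where
  nonneg : ∀ l → 0ℚ ≤ c l * (root i j (W l) - ι z)
  nonneg l = case c l ≟ 0ℚ of λ where
    (yes c≡0) → ≤-reflexive (sym (trans (*-comm (c l) (root i j (W l) - ι z)) (0≡* (root i j (W l) - ι z) c≡0)))
    (no  c≢0) → 0≤* (0≤c l) (0≤- (lower l c≢0))

InSlabs-comb : ∀ {m n} {W : Fin m → Pt n} {c x k} → ConvComb W c x →
               (∀ l → c l ≢ 0ℚ → InSlabs k (W l)) → InSlabs k x
InSlabs-comb {W = W} {c} {x} {k} comb slabs i j i≢j =
  lower-comb {W = W} comb i j (k i j) (λ l c≢0 → proj₁ (slabs l c≢0 i j i≢j)) ,
  lower⇒upper x i j k+1 (lower-comb {W = W} comb j i (ℤ.- k+1)
    (λ l c≢0 → upper⇒lower (W l) i j k+1 (proj₂ (slabs l c≢0 i j i≢j))))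
  where k+1 = k i j ℤ.+ ℤ.+ 1

-- A lattice hyperplane bounding x either bounds the whole region or contains one of its walls.
lower-support : ∀ {m n} {W : Fin m → Pt n} {c x k} → ConvComb W c x → (∀ l → InSlabs k (W l)) →
  ∀ i j → i ≢ j → ∀ z → LowerBound x i j z → ∀ l → c l ≢ 0ℚ → LowerBound (W l) i j z
lower-support {W = W} {c} {x} {k} comb@(0≤c , _) slabs i j i≢j z z≤x l c≢0 = case ι (k i j) <? ι z of λ where
    (no k≮z) → ≤-trans (≮⇒≥ k≮z) (proj₁ (slabs l i j i≢j))
    (yes k<z) → on-wall (≤-trans (ι-discrete (k i j) z k<z) z≤x)
  where
  k+1 = ι (k i j) + 1ℚ
  W≤k+1 : ∀ l → root i j (W l) ≤ k+1
  W≤k+1 l = subst (root i j (W l) ≤_) (ι-suc (k i j)) (proj₂ (slabs l i j i≢j))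
  gap : Fin _ → ℚ
  gap l = c l * (root i j (W l) - k+1)
  0≤-gap : ∀ l → 0ℚ ≤ - 1ℚ * gap l
  0≤-gap l = ≤-by (0≤* (0≤c l) (0≤- (W≤k+1 l))) (c l * (k+1 - root i j (W l)) ≡ - 1ℚ * (c l * (root i j (W l) - k+1)) - 0ℚ ∋
        solve 4 (λ a b c d → a :* (b :- (c :- d)) := (:- con 1ℚ) :* (a :* (c :- d :- b)) :- con 0ℚ)
          refl (c l) k+1 (W l i) (W l j))
  on-wall : k+1 ≤ root i j x → ι z ≤ root i j (W l)
  on-wall k+1≤x = ≤-trans z≤x (≤-trans x≤k+1 (≤-reflexive (sym W≡k+1)))
    where
    sum-gap : sumℚ (λ l → - 1ℚ * gap l) ≡ - 1ℚ * (root i j x - k+1)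
    sum-gap = trans (sum-* (- 1ℚ) gap) (cong (- 1ℚ *_) (root-comb {W = W} comb i j k+1))
    x≤k+1 : root i j x ≤ k+1
    x≤k+1 = ≤-by (subst (0ℚ ≤_) sum-gap (sum-nonneg 0≤-gap)) (- 1ℚ * (root i j x - k+1) ≡ k+1 - root i j x ∋
          solve 3 (λ a b c → (:- con 1ℚ) :* (a :- b :- c) := c :- (a :- b)) refl (x i) (x j) k+1)
    sum≡0 : sumℚ (λ l → - 1ℚ * gap l) ≡ 0ℚ
    sum≡0 = trans sum-gap (0≡* (- 1ℚ) (0≡- (≤-antisym x≤k+1 k+1≤x)))
    -- The weighted distances to the wall are nonnegative and sum to `0`, so each of them vanishes.
    W≡k+1 : root i j (W l) ≡ k+1
    W≡k+1 = ≡-by (*≡0 {c l} (*≡0 { - 1ℚ} (sum-nonneg-≡0 0≤-gap sum≡0 l) (λ ())) c≢0) refl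

InSlabs-support : ∀ {m n} {W : Fin m → Pt n} {c x k k′} → ConvComb W c x → (∀ l → InSlabs k (W l)) →
  InSlabs k′ x → ∀ l → c l ≢ 0ℚ → InSlabs k′ (W l)
InSlabs-support {W = W} {c} {x} {k} {k′} comb slabs x∈ l c≢0 i j i≢j =
  lower-support {W = W} {k = k} comb slabs i j i≢j (k′ i j) (proj₁ (x∈ i j i≢j)) l c≢0 ,
  lower⇒upper (W l) i j k+1 (lower-support {W = W} {k = k} comb slabs j i (i≢j ∘ sym) (ℤ.- k+1)
    (upper⇒lower x i j k+1 (proj₂ (x∈ i j i≢j))) l c≢0)
  where k+1 = k′ i j ℤ.+ ℤ.+ 1

-- A nonzero weight is a positive integer, hence at least `1`, and so exhausts the whole sum.
unit-coordinates : ∀ {m} (c : Fin m → ℚ) → (∀ l → 0ℚ ≤ c l) → (∀ l → IsInt (c l)) → sumℚ c ≡ 1ℚ →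
                   ∃[ l ] (∀ p → c p ≡ e l p)
unit-coordinates {m} c 0≤c int sum≡1 = case Fin.any? (λ l → ¬? (c l ≟ 0ℚ)) of λ where
    (no ¬p) → contradiction (trans (sym sum≡1) (sum-0 (λ l → decidable-stable (c l ≟ 0ℚ) (λ q → ¬p (l , q))))) (λ ())
    (yes (l , c≢0)) → l , λ p → ≡-by (sum-nonneg-≡0 (0≤c-e l c≢0) (sum-c-e l) p) refl
  where
  open ≡-Reasoning
  0≤c-e : ∀ l → c l ≢ 0ℚ → ∀ p → 0ℚ ≤ c p - e l p
  0≤c-e l c≢0 p = case l Fin.≟ p of λ where
    (yes refl) → let z , c≡z = int l in 0≤- (subst₂ _≤_ (trans (+-identityˡ 1ℚ) (sym (e-≡ l))) (sym c≡z)
      (ι-discrete (ℤ.+ 0) z (subst (0ℚ <_) c≡z (0≤∧≢0⇒0< (0≤c l) c≢0))))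
    (no l≢p) → 0≤- (subst (_≤ c p) (sym (e-≢ l p l≢p)) (0≤c p))
  sum-e : ∀ l → sumℚ (e {m} l) ≡ 1ℚ
  sum-e l = trans (sum-cong (λ p → sym (*-identityʳ (e l p)))) (dot-e l 𝟙)
  sum-c-e : ∀ l → sumℚ (λ p → c p - e l p) ≡ 0ℚ
  sum-c-e l = trans (sum-minus c (e l)) (0≡- (trans sum≡1 (sym (sum-e l))))

-- Lattice points and unimodularity of a region

module _ {d} {k : Fin (suc d) → Fin (suc d) → ℤ} (A : Alcove k) where

  open Alcove A

  alcove-Conv : ∀ x → InV x → InSlabs k x → ConvComb W (λ l → coord l x) x
  alcove-Conv x x∈V x∈ = 0≤coord x x∈ , sum-coord x , expand x x∈V

  Conv-slabs : ∀ {x} → Conv W x → InSlabs k x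
  Conv-slabs (c , comb) = InSlabs-comb {W = W} {k = k} comb (λ l _ → W-slabs l)

  -- The barycentric coordinates of such a point are nonnegative integers with sum `1`, so they form
  -- a unit vector.
  lattice-vertex : ∀ p → InΛ p → InSlabs k p → ∃[ l ] p ≐ W l
  lattice-vertex p p∈Λ p∈ = at (unit-coordinates (λ l → coord l p) (0≤coord p p∈) (int-coord p p∈Λ) (sum-coord p))
    where
    at : (∃[ l ] (∀ q → coord q p ≡ e l q)) → ∃[ l ] p ≐ W l
    at (l , eq) = l , λ i → trans (expand p (proj₁ p∈Λ) i)
      (trans (sum-cong (λ q → cong (_* W q i) (eq q))) (dot-e l (λ q → W q i)))

  -- The lattice point `W zero + y` has integral barycentric coordinates. Subtracting `W zero` with
  -- total weight `1` turns its expansion into an integral combination of edge vectors.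
  unimodular : ∀ (y : Pt (suc d)) → InΛ y → Σ (Fin d → ℤ) λ c → ∀ i →
               y i ≡ sumℚ (λ l → ι (c l) * (W (suc l) i - W zero i))
  unimodular y y∈Λ = (λ l → proj₁ (int (suc l))) , λ i → begin
      y i
        ≡⟨ solve 2 (λ a b → a := b :+ a :- b) refl (y i) (W zero i) ⟩
      W zero i + y i - W zero i                                     ≡⟨ cong₂ _-_ (expand x (proj₁ x∈Λ) i)
                                                                        (trans (sym (*-identityˡ (W zero i))) (cong (_* W zero i) (sym (sum-coord x)))) ⟩
      c zero * W zero i + sumℚ (λ l → c (suc l) * W (suc l) i) - (c zero + sumℚ (c ∘ suc)) * W zero i
        ≡⟨ solve 4 (λ a b c d → a :* b :+ c :- (a :+ d) :* b := c :+ (:- b) :* d)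
              refl (c zero) (W zero i) (sumℚ (λ l → c (suc l) * W (suc l) i)) (sumℚ (c ∘ suc)) ⟩
      sumℚ (λ l → c (suc l) * W (suc l) i) + - W zero i * sumℚ (c ∘ suc)
        ≡⟨ sum-+* (λ l → c (suc l) * W (suc l) i) (- W zero i) (c ∘ suc) ⟨
      sumℚ (λ l → c (suc l) * W (suc l) i + - W zero i * c (suc l))
        ≡⟨ sum-cong (λ l → trans
             (c (suc l) * W (suc l) i + - W zero i * c (suc l) ≡ c (suc l) * (W (suc l) i - W zero i) ∋
                   solve 3 (λ a b c → a :* b :+ (:- c) :* a := a :* (b :- c))
                     refl (c (suc l)) (W (suc l) i) (W zero i))
             (cong (_* (W (suc l) i - W zero i)) (proj₂ (int (suc l))))) ⟩
      sumℚ (λ l → ι (proj₁ (int (suc l))) * (W (suc l) i - W zero i)) ∎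
    where
    open ≡-Reasoning
    x : Pt (suc d)
    x i = W zero i + y i
    x∈Λ : InΛ x
    x∈Λ = trans (sum-+ (W zero) y) (0≡+ (proj₁ (W∈Λ zero)) (proj₁ y∈Λ)) , λ i j i≢j →
      subst IsInt (root i j (W zero) - root j i y ≡ root i j x ∋ sum-root i j)
        (IsInt-minus (proj₂ (W∈Λ zero) i j i≢j) (proj₂ y∈Λ j i (i≢j ∘ sym)))
      where
      sum-root : ∀ i j → root i j (W zero) - root j i y ≡ W zero i + y i - (W zero j + y j)
      sum-root i j =
            (solve 4 (λ a b c d → a :- b :- (c :- d) := a :+ d :- (b :+ c))
              refl (W zero i) (W zero j) (y j) (y i))
    c : Fin (suc d) → ℚ
    c l = coord l x
    int : ∀ l → IsInt (c l)
    int = int-coord x x∈Λ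

-- Regularity

IsAffine : ∀ {n} → (Pt n → ℚ) → Set
IsAffine {n} F = Σ (Pt n) λ a → Σ ℚ λ b → ∀ p → ⟨ a , p ⟩ + b ≡ F p

affine-root : ∀ {n} (i j : Fin n) s c → IsAffine (λ p → s * root i j p - c)
affine-root i j s c = axpy (λ l → s * e i l) (- s) (e j) , - c , λ p → begin
  ⟨ axpy (λ l → s * e i l) (- s) (e j) , p ⟩ + - c
    ≡⟨ cong (_+ - c) (dot-axpyˡ (λ l → s * e i l) (- s) (e j) p) ⟩
  ⟨ (λ l → s * e i l) , p ⟩ + - s * ⟨ e j , p ⟩ + - c
    ≡⟨ cong₂ (λ u v → u + - s * v + - c)
         (trans (sum-cong (λ l → *-assoc s (e i l) (p l))) (trans (sum-* s (λ l → e i l * p l)) (cong (s *_) (dot-e i p))))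
         (dot-e j p) ⟩
  s * p i + - s * p j + - c
    ≡⟨ solve 4 (λ a b c d → a :* b :+ (:- a) :* c :+ (:- d) := a :* (b :- c) :- d) refl s (p i) (p j) c ⟩
  s * root i j p - c ∎
  where open ≡-Reasoning

affine-sum : ∀ {m n} {F : Fin m → Pt n → ℚ} → (∀ l → IsAffine (F l)) → IsAffine (λ p → sumℚ (λ l → F l p))
affine-sum {zero} aff = (λ _ → 0ℚ) , 0ℚ , λ p → trans (+-identityʳ ⟨ (λ _ → 0ℚ) , p ⟩) (sum-0 (λ i → *-zeroˡ (p i)))
affine-sum {suc m} {F = F} aff = add (aff zero) (affine-sum (aff ∘ suc))
  where
  add : IsAffine (F zero) → IsAffine (λ p → sumℚ (λ l → F (suc l) p)) → IsAffine (λ p → sumℚ (λ l → F l p))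
  add (a , b , eq) (a′ , b′ , eq′) = axpy a 1ℚ a′ , b + b′ , λ p → begin
    ⟨ axpy a 1ℚ a′ , p ⟩ + (b + b′)           ≡⟨ cong (_+ (b + b′)) (dot-axpyˡ a 1ℚ a′ p) ⟩
    ⟨ a , p ⟩ + 1ℚ * ⟨ a′ , p ⟩ + (b + b′)
      ≡⟨ solve 4 (λ a b c d → a :+ con 1ℚ :* b :+ (c :+ d) := a :+ c :+ (b :+ d))
           refl (⟨ a , p ⟩) (⟨ a′ , p ⟩) b b′ ⟩
    (⟨ a , p ⟩ + b) + (⟨ a′ , p ⟩ + b′)        ≡⟨ cong₂ _+_ (eq p) (eq′ p) ⟩
    F zero p + sumℚ (λ l → F (suc l) p) ∎
    where open ≡-Reasoning

ω : ∀ {n} → Pt n → ℚ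
ω p = sumℚ (λ i → sumℚ (λ j → root i j p * root i j p))

-- s² lies above its secant through s = k and s = k + 1 at all integers, with equality only there.
parabola : ℚ → ℚ → ℚ
parabola k s = (s - k) * (s - (k + 1ℚ))

parabola-nonneg : ∀ k s → 0ℚ ≤ parabola (ι k) (ι s)
parabola-nonneg k s = case ι k <? ι s of λ where
  (yes k<s) → 0≤* (0≤- (<⇒≤ k<s)) (0≤- (ι-discrete k s k<s))
  (no k≮s) → ≤-by (0≤* (0≤- (≮⇒≥ k≮s)) (0≤+ (0≤- (≮⇒≥ k≮s)) 0≤1))
    ((ι k - ι s) * (ι k - ι s + 1ℚ) ≡ (ι s - ι k) * (ι s - (ι k + 1ℚ)) - 0ℚ ∋
          solve 2 (λ a b → (a :- b) :* (a :- b :+ con 1ℚ) := (b :- a) :* (b :- (a :+ con 1ℚ)) :- con 0ℚ)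
            refl (ι k) (ι s))

parabola-zero : ∀ k s → parabola (ι k) (ι s) ≡ 0ℚ → ι k ≤ ι s × ι s ≤ ι k + 1ℚ
parabola-zero k s eq = case ι s - ι k ≟ 0ℚ of λ where
  (yes s-k≡0) → let s≡k = ≡-by s-k≡0 refl in
    ≤-reflexive (sym s≡k) , ≤-trans (≤-reflexive s≡k) (≤-by 0≤1 (1ℚ ≡ ι k + 1ℚ - ι k ∋
          solve 1 (λ a → con 1ℚ := a :+ con 1ℚ :- a) refl (ι k)))
  (no s-k≢0) → let s≡k+1 = ≡-by (*≡0 {ι s - ι k} eq s-k≢0) refl in
    ≤-trans (≤-by 0≤1 (1ℚ ≡ ι k + 1ℚ - ι k ∋
          solve 1 (λ a → con 1ℚ := a :+ con 1ℚ :- a) refl (ι k))) (≤-reflexive (sym s≡k+1)) , ≤-reflexive s≡k+1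

parabola-slab : ∀ k s → ι k ≤ ι s → ι s ≤ ι k + 1ℚ → parabola (ι k) (ι s) ≡ 0ℚ
parabola-slab k s k≤s s≤k+1 = ≤-antisym
  (≤-by (0≤* (0≤- k≤s) (0≤- s≤k+1)) ((ι s - ι k) * (ι k + 1ℚ - ι s) ≡ 0ℚ - (ι s - ι k) * (ι s - (ι k + 1ℚ)) ∋
        solve 2 (λ a b → (a :- b) :* (b :+ con 1ℚ :- a) := con 0ℚ :- (a :- b) :* (a :- (b :+ con 1ℚ)))
          refl (ι s) (ι k)))
  (parabola-nonneg k s)

module Lift {n} (k : Fin n → Fin n → ℤ) where

  -- the diagonal of k carries no information
  κ : Fin n → Fin n → ℤ
  κ i j = case i Fin.≟ j of λ { (yes _) → ℤ.+ 0 ; (no _) → k i j }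

  κ-≢ : ∀ {i j} → i ≢ j → κ i j ≡ k i j
  κ-≢ {i} {j} i≢j with i Fin.≟ j
  ... | yes i≡j = contradiction i≡j i≢j
  ... | no  _   = refl

  κ-≡ : ∀ i → κ i i ≡ ℤ.+ 0
  κ-≡ i with i Fin.≟ i
  ... | yes _  = refl
  ... | no i≢i = contradiction refl i≢i

  secant : Fin n → Fin n → Pt n → ℚ
  secant i j p = (ι (κ i j) + (ι (κ i j) + 1ℚ)) * root i j p - ι (κ i j) * (ι (κ i j) + 1ℚ)

  excess : Fin n → Fin n → Pt n → ℚ
  excess i j p = parabola (ι (κ i j)) (root i j p)

  total : (Fin n → Fin n → ℚ) → ℚ
  total h = sumℚ (λ i → sumℚ (λ j → h i j))

  affine : IsAffine (λ p → total (λ i j → secant i j p))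
  affine = affine-sum (λ i → affine-sum (λ j →
    affine-root i j (ι (κ i j) + (ι (κ i j) + 1ℚ)) (ι (κ i j) * (ι (κ i j) + 1ℚ))))

  ω≡ : ∀ p → total (λ i j → excess i j p) ≡ ω p - total (λ i j → secant i j p)
  ω≡ p = begin
    sumℚ (λ i → sumℚ (λ j → excess i j p))
      ≡⟨ sum-cong (λ i → trans (sum-cong (λ j → split (ι (κ i j)) (root i j p))) (sum-minus (λ j → root i j p * root i j p) (λ j → secant i j p))) ⟩
    sumℚ (λ i → sumℚ (λ j → root i j p * root i j p) - sumℚ (λ j → secant i j p))
      ≡⟨ sum-minus (λ i → sumℚ (λ j → root i j p * root i j p)) (λ i → sumℚ (λ j → secant i j p)) ⟩
    ω p - total (λ i j → secant i j p) ∎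
    where
    open ≡-Reasoning
    split : ∀ k s → (s - k) * (s - (k + 1ℚ)) ≡ s * s - ((k + (k + 1ℚ)) * s - k * (k + 1ℚ))
    split k s =
          (solve 2 (λ a b → (a :- b) :* (a :- (b :+ con 1ℚ)) := a :* a :- ((b :+ (b :+ con 1ℚ)) :* a :- b :* (b :+ con 1ℚ)))
            refl s k)

  excess-nonneg : ∀ p → InΛ p → ∀ i j → 0ℚ ≤ excess i j p
  excess-nonneg p p∈Λ i j = at (IsInt-root {x = p} p∈Λ i j)
    where
    at : IsInt (root i j p) → 0ℚ ≤ excess i j p
    at (s , eq) = subst (λ u → 0ℚ ≤ parabola (ι (κ i j)) u) (sym eq) (parabola-nonneg (κ i j) s)

  excess-zero : ∀ p → InΛ p → InSlabs k p → ∀ i j → excess i j p ≡ 0ℚ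
  excess-zero p p∈Λ p∈ i j = case i Fin.≟ j of λ where
      -- On the diagonal both `κ` and the root are `0`, and the parabola vanishes there.
      (yes refl) → trans (cong₂ parabola (cong ι (κ-≡ i)) (+-inverseʳ (p i))) refl
      (no i≢j)   → at i≢j (IsInt-root {x = p} p∈Λ i j)
    where
    at : i ≢ j → IsInt (root i j p) → excess i j p ≡ 0ℚ
    at i≢j (s , eq) = trans (cong₂ parabola (cong ι (κ-≢ i≢j)) eq)
      (parabola-slab (k i j) s (subst (ι (k i j) ≤_) eq (proj₁ (p∈ i j i≢j))) (subst₂ _≤_ eq (ι-suc (k i j)) (proj₂ (p∈ i j i≢j))))

  zero-excess : ∀ p → InΛ p → (∀ i j → excess i j p ≡ 0ℚ) → InSlabs k p
  zero-excess p p∈Λ zeros i j i≢j = at (IsInt-root {x = p} p∈Λ i j)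
    where
    at : IsInt (root i j p) → (ι (k i j) ≤ root i j p) × (root i j p ≤ ι (k i j ℤ.+ ℤ.+ 1))
    at (s , eq) = let lo , hi = parabola-zero (k i j) s (trans (cong₂ parabola (cong ι (sym (κ-≢ i≢j))) (sym eq)) (zeros i j)) in
      subst (ι (k i j) ≤_) (sym eq) lo , subst₂ _≤_ (sym eq) (sym (ι-suc (k i j))) hi

  touches : ∀ p → InΛ p → InSlabs k p → ⟨ proj₁ affine , p ⟩ + proj₁ (proj₂ affine) ≡ ω p
  touches p p∈Λ p∈ = trans (proj₂ (proj₂ affine) p) (sym (≡-by
    (sum-0 (λ i → sum-0 (λ j → excess-zero p p∈Λ p∈ i j))) (ω≡ p)))

  -- If the nonnegative excesses summed to `0`, all of them would vanish and `p` would lie in the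
  -- region.
  below : ∀ p → InΛ p → ¬ InSlabs k p → ⟨ proj₁ affine , p ⟩ + proj₁ (proj₂ affine) < ω p
  below p p∈Λ p∉ = subst (_< ω p) (sym (proj₂ (proj₂ affine) p))
    (<-by (0≤∧≢0⇒0< (sum-nonneg rows) (λ eq → p∉ (zero-excess p p∈Λ
      (λ i → sum-nonneg-≡0 (excess-nonneg p p∈Λ i) (sum-nonneg-≡0 rows eq i))))) (ω≡ p))
    where
    rows : ∀ i → 0ℚ ≤ sumℚ (λ j → excess i j p)
    rows i = sum-nonneg (excess-nonneg p p∈Λ i)

-- The triangulation

-- Ensures that a pair taken from at least three elements is a proper subset.
third : ∀ {r} (a b : Fin (suc (suc (suc r)))) → ∃[ c ] (c ≢ a × c ≢ b)
third zero          zero          = suc zero , (λ ()) , (λ ())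
third zero          (suc zero)    = suc (suc zero) , (λ ()) , (λ ())
third zero          (suc (suc b)) = suc zero , (λ ()) , (λ ())
third (suc zero)    zero          = suc (suc zero) , (λ ()) , (λ ())
third (suc (suc a)) zero          = suc zero , (λ ()) , (λ ())
third (suc a)       (suc b)       = zero , (λ ()) , (λ ())

module Dicing {m d} (vs : Fin m → Pt (suc d)) (typeA : IsTypeA vs) where

  P = Polytope vs
  I = DicingIndex vs

  inV : ∀ l → InV (vs l)
  inV l = proj₁ (proj₁ typeA l)

  full : FullDimInV P
  full = proj₁ (proj₂ typeA)

  P⊆V : ∀ {x} → P x → InV x
  P⊆V = Conv-InV {vs = vs} inV

  C : I → Pt (suc d) → Set
  C t = DicingCell vs (proj₁ t)

  interior : (t : I) → Σ (Pt (suc d)) λ y → P y × InOpenSlabs (proj₁ t) y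
  interior (k , full-cell) = full⇒interior vs inV {k} full-cell

  A : (t : I) → Alcove (proj₁ t)
  A t@(k , _) = alcove k (proj₁ (interior t)) (proj₂ (proj₂ (interior t)))

  W : I → Fin (suc d) → Pt (suc d)
  W t = Alcove.W (A t)

  W∈Λ : ∀ t l → InΛ (W t l)
  W∈Λ t = Alcove.W∈Λ (A t)

  W-slabs : ∀ t l → InSlabs (proj₁ t) (W t l)
  W-slabs t = Alcove.W-slabs (A t)

  slabs⊆P : ∀ t {x} → InV x → InSlabs (proj₁ t) x → P x
  slabs⊆P t@(k , _) = region⊆P vs typeA {k} (proj₁ (proj₂ (interior t))) (proj₂ (proj₂ (interior t)))

  cell-comb : ∀ t x → C t x → ConvComb (W t) (λ l → Alcove.coord (A t) l x) x
  cell-comb t x (x∈P , x∈) = alcove-Conv (A t) x (P⊆V x∈P) x∈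

  cell : ∀ t x → C t x ⇔ Conv (W t) x
  cell t x = mk⇔ (λ x∈C → _ , cell-comb t x x∈C)
    (λ x∈W → slabs⊆P t (Conv-InV {vs = W t} (λ l → proj₁ (W∈Λ t l)) x∈W) (Conv-slabs (A t) x∈W) , Conv-slabs (A t) x∈W)

  W∈C : ∀ t l → C t (W t l)
  W∈C t l = Equivalence.from (cell t (W t l)) (Conv-vertex (W t) l)

  cover : ∀ x → P x → ∃[ t ] C t x
  cover x x∈P = at (generic-point vs inV full x x∈P)
    where
    at : (Σ (Pt (suc d)) λ y → P y × ∃[ k ] (InOpenSlabs k y × InSlabs k x)) → ∃[ t ] C t x
    -- The index carries a proof that its cell is full-dimensional; the vertices of the region of
    -- `y` supply it, as `region⊆P` puts them in `P`.
    at (y , y∈P , k , y-open , x∈) = (k , Alcove.W B ,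
        (λ l → region⊆P vs typeA {k} y∈P y-open (proj₁ (Alcove.W∈Λ B l)) (Alcove.W-slabs B l) , Alcove.W-slabs B l) ,
        Alcove.aff-ind B) , x∈P , x∈
      where B = alcove k y y-open

  -- The vertices of cell `t` with nonzero weight in `x` lie in the slabs of `u`; being lattice
  -- points, they are vertices of `u`. Conversely, a combination of common vertices stays in both
  -- cells.
  intersection : ∀ t u x → (C t x × C u x) ⇔
    (∃[ lam ] ConvComb (W t) lam x × (∀ l → lam l ≢ 0ℚ → ∃[ l′ ] W t l ≐ W u l′))
  intersection t u x = mk⇔
    (λ { (x∈t , x∈P , x∈u) → _ , cell-comb t x x∈t , λ l c≢0 →
      lattice-vertex (A u) (W t l) (W∈Λ t l)
        (InSlabs-support {W = W t} {k = proj₁ t} {proj₁ u} (cell-comb t x x∈t) (W-slabs t) x∈u l c≢0) })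
    (λ { (lam , comb , common) → let x∈t = Equivalence.from (cell t x) (lam , comb) in
      x∈t , proj₁ x∈t , InSlabs-comb {W = W t} {k = proj₁ u} comb λ l c≢0 →
        let l′ , eq = common l c≢0 in InSlabs-≐ {k = proj₁ u} {y = W u l′} eq (W-slabs u l′) })

  regular : ∀ t → Σ (Pt (suc d)) λ a → Σ ℚ λ b →
    (∀ l → ⟨ a , W t l ⟩ + b ≡ ω (W t l)) ×
    (∀ p → InΛ p → P p → (∀ l → ¬ (p ≐ W t l)) → ⟨ a , p ⟩ + b < ω p)
  regular t = proj₁ affine , proj₁ (proj₂ affine) , (λ l → touches (W t l) (W∈Λ t l) (W-slabs t l)) ,
    λ p p∈Λ _ p∉W → below p p∈Λ (λ p∈ → let l , eq = lattice-vertex (A t) p p∈Λ p∈ in p∉W l eq)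
    where open Lift (proj₁ t)

  module _ {r} (S : Fin r → Pt (suc d)) (S-vertex : ∀ a → IsVertex P I C W (S a)) where

    face⇒slabs : ∀ {t a} → (∃[ l ] S a ≐ W t l) → InSlabs (proj₁ t) (S a)
    face⇒slabs {t} (l , eq) = InSlabs-≐ {k = proj₁ t} {y = W t l} eq (W-slabs t l)

    S∈Λ : ∀ a → InΛ (S a)
    S∈Λ a = let t , l , eq = S-vertex a in InΛ-≐ {y = W t l} eq (W∈Λ t l)

    S∈P : ∀ a → P (S a)
    S∈P a = let t , l , eq = S-vertex a in Conv-≐ {y = W t l} eq (proj₁ (W∈C t l))

  -- Pairwise adjacent vertices differ by at most 1 under every root, so the cell of their
  -- barycentre contains them all.
  module Clique {r} (S : Fin (suc r) → Pt (suc d)) (S-vertex : ∀ a → IsVertex P I C W (S a))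
                (adjacent : ∀ a b → ∃[ t ] (∃[ l ] S a ≐ W t l) × (∃[ l ] S b ≐ W t l)) where

    spread : ∀ a b i j → i ≢ j → root i j (S a) ≤ root i j (S b) + 1ℚ
    spread a b i j i≢j = at (adjacent a b)
      where
      at : (∃[ t ] (∃[ l ] S a ≐ W t l) × (∃[ l ] S b ≐ W t l)) → root i j (S a) ≤ root i j (S b) + 1ℚ
      at (t@(k , _) , a∈ , b∈) = ≤-trans (subst (root i j (S a) ≤_) (ι-suc (k i j)) (proj₂ (face⇒slabs S S-vertex {t} a∈ i j i≢j)))
        (+-monoˡ-≤ 1ℚ (proj₁ (face⇒slabs S S-vertex {t} b∈ i j i≢j)))

    β : Pt (suc d)
    β = barycentre S

    -- If the root at `S a` were below the integer `k`, it would be at most `k - 1`. By `spread` it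
    -- would be at most `k` on all of `S`, and strictly less at `a`, so the mean would be below `k`.
    slab-lower : ∀ k a i j → i ≢ j → ι k ≤ root i j β → ι k ≤ root i j (S a)
    slab-lower k a i j i≢j k≤β = ≮⇒≥ λ Sa<k → <-irrefl refl (<-≤-trans
      (mean-< (ι k) (λ b → root i j (S b)) (λ b → ≤-trans (spread b a i j i≢j) (Sa+1≤k (IsInt-root {x = S a} (S∈Λ S S-vertex a) i j) Sa<k)) (a , Sa<k))
      (subst (ι k ≤_) (root-barycentre i j S) k≤β))
      where
      Sa+1≤k : IsInt (root i j (S a)) → root i j (S a) < ι k → root i j (S a) + 1ℚ ≤ ι k
      Sa+1≤k (s , eq) Sa<k = subst (λ u → u + 1ℚ ≤ ι k) (sym eq) (ι-discrete s k (subst (_< ι k) eq Sa<k))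

    S-slabs : ∀ t → C t β → ∀ a → InSlabs (proj₁ t) (S a)
    S-slabs (k , _) (_ , β∈) a i j i≢j = slab-lower (k i j) a i j i≢j (proj₁ (β∈ i j i≢j)) ,
      lower⇒upper (S a) i j k+1 (slab-lower (ℤ.- k+1) a j i (i≢j ∘ sym) (upper⇒lower β i j k+1 (proj₂ (β∈ i j i≢j))))
      where k+1 = k i j ℤ.+ ℤ.+ 1

    face : IsFaceSel P I C W S (λ _ → true)
    face = at (cover β (Conv-Conv {vs = vs} {W = S} (S∈P S S-vertex) (Conv-barycentre S)))
      where
      at : (∃[ t ] C t β) → IsFaceSel P I C W S (λ _ → true)
      at (t , β∈C) = t , λ a _ → lattice-vertex (A t) (S a) (S∈Λ S S-vertex a) (S-slabs t β∈C a)

  -- Sets of at most one vertex are faces. Among three or more elements each pair is a proper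
  -- subset, hence a face by minimality, and `Clique.face` makes the whole set a face.
  flag : ∀ r (S : Fin r → Pt (suc d)) →
    (∀ a b → a ≢ b → ¬ (S a ≐ S b)) →
    (∀ a → IsVertex P I C W (S a)) →
    ¬ IsFaceSel P I C W S (λ _ → true) →
    (∀ mask → (∃[ a ] mask a ≡ false) → IsFaceSel P I C W S mask) →
    r ≡ 2
  -- The empty set is a face of any cell, and some cell exists because `P` contains a point.
  flag zero S _ _ ¬face _ = ⊥-elim (¬face (proj₁ (cover (proj₁ full zero) (proj₁ (proj₂ full) zero)) , λ ()))
  flag (suc zero) S _ S-vertex ¬face _ =
    let t , l , eq = S-vertex zero in ⊥-elim (¬face (t , λ { zero _ → l , eq }))
  flag (suc (suc zero)) _ _ _ _ _ = refl
  flag (suc (suc (suc r))) S _ S-vertex ¬face proper = ⊥-elim (¬face (Clique.face S S-vertex adjacent))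
    where
    pair : ∀ (a b c : Fin (suc (suc (suc r)))) → Bool
    pair a b c = does (c Fin.≟ a) ∨ does (c Fin.≟ b)
    pair-left : ∀ a b → pair a b a ≡ true
    pair-left a b = cong (_∨ does (a Fin.≟ b)) (dec-true (a Fin.≟ a) refl)
    pair-right : ∀ a b → pair a b b ≡ true
    pair-right a b = trans (cong (does (b Fin.≟ a) ∨_) (dec-true (b Fin.≟ b) refl)) (∨-zeroʳ (does (b Fin.≟ a)))
    adjacent : ∀ a b → ∃[ t ] (∃[ l ] S a ≐ W t l) × (∃[ l ] S b ≐ W t l)
    adjacent a b =
      let c , c≢a , c≢b = third a b
          t , on = proper (pair a b) (c , cong₂ _∨_ (dec-false (c Fin.≟ a) c≢a) (dec-false (c Fin.≟ b) c≢b))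
      in t , on a (pair-left a b) , on b (pair-right a b)

  triangulation : IsQuadraticTriangulation P I C
  triangulation = W ,
    (λ t → Alcove.aff-ind (A t) , cell t) ,
    (λ x → mk⇔ (cover x) (λ { (t , x∈P , _) → x∈P })) ,
    intersection ,
    (λ t → W∈Λ t , unimodular (A t)) ,
    (ω , regular) ,
    flag

-- For `n = 0` truncated subtraction gives `dimV 0 = 0`, so `V` is a point and each cell is a
-- simplex with one vertex. All points agree coordinatewise, so every set of vertices is a face.
Pt0-triangulation : ∀ {m} (vs : Fin m → Pt 0) → IsTypeA vs →
  IsQuadraticTriangulation (Polytope vs) (DicingIndex vs) (λ t → DicingCell vs (proj₁ t))
Pt0-triangulation {m} vs (_ , (V , V∈P , _) , _) = W ,
    (λ t → aff t , λ x → mk⇔ (λ _ → 𝟙 , comb t x) (λ _ → P-all x , λ ())) ,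
    (λ x → mk⇔ (λ x∈P → t₀ , x∈P , λ ()) (λ _ → P-all x)) ,
    (λ t u x → mk⇔ (λ _ → 𝟙 , comb t x , λ _ _ → zero , λ ()) (λ _ → (P-all x , λ ()) , P-all x , λ ())) ,
    (λ t → (λ l → refl , λ ()) , λ _ _ → (λ ()) , λ ()) ,
    ((λ _ → 0ℚ) , λ t → (λ ()) , 0ℚ , (λ _ → refl) , λ p _ _ p≢ → ⊥-elim (p≢ zero (λ ()))) ,
    flag
  where
  I = DicingIndex vs
  C : I → Pt 0 → Set
  C t = DicingCell vs (proj₁ t)
  P-all : ∀ x → Polytope vs x
  -- The weights come from the witness of full dimension; there are no coordinates left to compare.
  P-all x = let c , 0≤c , sum≡1 , _ = V∈P zero in c , 0≤c , sum≡1 , λ ()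
  t₀ : I
  t₀ = (λ ()) , V , (λ l → P-all (V l) , λ ()) , aff-V
    where
    aff-V : AffInd V
    aff-V c sum≡0 _ zero = trans (sym (+-identityʳ (c zero))) sum≡0
  W : I → Fin 1 → Pt 0
  W _ _ = λ ()
  aff : ∀ t → AffInd (W t)
  aff t c sum≡0 _ zero = trans (sym (+-identityʳ (c zero))) sum≡0
  comb : ∀ t x → ConvComb (W t) 𝟙 x
  comb t x = (λ _ → 0≤1) , refl , λ ()
  flag : ∀ r (S : Fin r → Pt 0) →
    (∀ a b → a ≢ b → ¬ (S a ≐ S b)) →
    (∀ a → IsVertex (Polytope vs) I C W (S a)) →
    ¬ IsFaceSel (Polytope vs) I C W S (λ _ → true) →
    (∀ mask → (∃[ a ] mask a ≡ false) → IsFaceSel (Polytope vs) I C W S mask) →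
    r ≡ 2
  flag r S _ _ ¬face _ = ⊥-elim (¬face (t₀ , λ _ _ → zero , λ ()))

theorem3p3 : (n m : ℕ) (vs : Fin m → Pt n) → IsTypeA vs →
    IsQuadraticTriangulation (Polytope vs) (DicingIndex vs)
      (λ t → DicingCell vs (proj₁ t))
theorem3p3 zero    m vs typeA = Pt0-triangulation vs typeA
theorem3p3 (suc d) m vs typeA = Dicing.triangulation vs typeA
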